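{- Let $S = \langle a, ah+d, ah+2d, \ldots, ah+kd\rangle$ be an extra-generalized arithmetical numerical semigroup, and let $F\subset\mathcal{C}(\mathbb{Z}_a)$ be the face containing $S$. Then $$\dim F = \begin{cases} a-1 & \text{if } k=a-1;\\ \lfloor \tfrac{a}{2}\rfloor & \text{if } k=a-2;\\ 2 & \text{if } 1<k<a-2;\\ 1 & \text{if } k=1.\end{cases}$$
   Context: A numerical semigroup is a subset $S \subseteq \mathbb{Z}_{\ge 0}$ containing $0$, closed under addition, with finite complement; $\langle n_1,\ldots,n_k\rangle$ denotes the set of all non-negative integer combinations of $n_1,\ldots,n_k$. For $m \in S$, $m>0$, the Apéry set $\operatorname{Ap}(S;m) = \{n \in S : n-m\notin S\}$ has exactly one element in each residue class modulo $m$; writing $\operatorname{Ap}(S;m) = \{0,a_1,\ldots,a_{m-1}\}$ with $a_i\equiv i \bmod m$, the Apéry tuple of $S$ (with respect to $m$) is $(a_1,\ldots,a_{m-1})$. For $m\ge 2$, the group cone $\mathcal{C}(\mathbb{Z}_m)\subset\mathbb{R}^{m-1}$ (coordinates indexed by $\mathbb{Z}_m\setminus\{0\}$) is the cone defined by the inequalities $x_i+x_j\ge x_{i+j}$ for $i,j\in\mathbb{Z}_m\setminus\{0\}$ with $i+j\ne 0$. Every Apéry tuple with respect to $m$ lies in it. A face $F$ of $\mathcal{C}(\mathbb{Z}_m)$ contains a numerical semigroup $S$ (with $m\in S$) if the Apéry tuple of $S$ lies in the relative interior of $F$. The dimension of a face is the dimension of its affine span. An extra-generalized arithmetical numerical semigroup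 is a numerical semigroup of the form $S = \langle a, ah+d, ah+2d,\ldots, ah+kd\rangle$ with $a,h,k \in \mathbb{Z}_{\ge 1}$ and $d\in\mathbb{Z}$ such that $k<a$, $\gcd(a,d)=1$, and $ah+kd>a$.
   Formalization: The generators a, ah+d, …, ah+kd are additionally assumed to be minimal (none redundant); otherwise the claim fails, e.g. a=3, h=4, k=2, d=−4 gives ⟨3,4⟩ with dim F = 1, not 2. The cone is taken over an arbitrary ordered field, such as ℝ. -}

module Defs where

open import Level using (_⊔_) renaming (suc to lsuc)
open import Algebra.Bundles using (CommutativeRing)
open import Algebra.Structures using (IsCommutativeRing)
import Algebra.Properties.Semiring.Mult
import Algebra.Properties.Semiring.Sum
open import Data.Fin.Base using (Fin; zero; suc; toℕ)
open import Data.Integer.Base as ℤ using (ℤ; +_)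
open import Data.Integer.GCD using (gcd)
import Data.Integer.Properties as ℤ
open import Data.Nat.Base as ℕ using (ℕ; _∸_; _%_; NonZero)
open import Data.Product.Base using (Σ-syntax; ∃-syntax; _×_)
open import Data.Vec.Functional using (Vector; removeAt)
import Relation.Binary.Construct.StrictToNonStrict
open import Relation.Binary.Core using (Rel)
open import Relation.Binary.PropositionalEquality.Core using (_≡_)
open import Relation.Binary.Structures using (IsStrictTotalOrder)
open import Relation.Nullary.Negation.Core using (¬_)
open import Relation.Unary using (Pred; _∈_; _∉_; _∩_; _≐_)

record IsNumericalSemigroup {p} (S : Pred ℕ p) : Set p where
  field
    0∈       : 0 ∈ S
    +-closed : ∀ {m n} → m ∈ S → n ∈ S → m ℕ.+ n ∈ S
    cofinite : ∃[ N ] (∀ n → N ℕ.≤ n → n ∈ S)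

-- Generators are kept in ℤ because they are computed from an integer d.
⟨_⟩ : ∀ {n} → Vector ℤ n → Pred ℤ _
⟨_⟩ {n} g z = Σ[ c ∈ Vector ℕ n ] z ≡ sum (λ i → + c i ℤ.* g i)
  where open Algebra.Properties.Semiring.Sum ℤ.+-*-semiring using (sum)

-- No generator is redundant.  Without this, k is not determined by the semigroup:
-- a , h , k , d = 3 , 4 , 2 , -4 gives ⟨ 3 , 8 , 4 ⟩ = ⟨ 3 , 4 ⟩, which also arises
-- from 3 , 1 , 1 , 1; its Apéry tuple (4 , 8) lies on the extreme ray 2 x₁ = x₂.
IsMinimalGeneratingFamily : ∀ {n} → Vector ℤ (ℕ.suc n) → Set
IsMinimalGeneratingFamily g = ∀ i → g i ∉ ⟨ removeAt g i ⟩

-- n - m is taken in ℤ: it lies in S iff it is some r ∈ ℕ with r ∈ S.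
Apéry : ∀ {p} → Pred ℕ p → ℕ → Pred ℕ p
Apéry S m n = n ∈ S × ¬ (∃[ r ] (r ℕ.+ m ≡ n × r ∈ S))

-- Fin (m ∸ 1) indexes the nonzero residues 1, …, m - 1 modulo m.
residue : ∀ {n} → Fin n → ℕ
residue i = ℕ.suc (toℕ i)

IsApéryTuple : ∀ {p} → Pred ℕ p → (m : ℕ) .{{_ : NonZero m}} → Vector ℕ (m ∸ 1) → Set p
IsApéryTuple S m w = ∀ i → w i ∈ Apéry S m × w i % m ≡ residue i

generators : (a h k : ℕ) → ℤ → Vector ℤ (ℕ.suc k)
generators a h k d zero    = + a
generators a h k d (suc j) = + (a ℕ.* h) ℤ.+ + residue j ℤ.* d

record IsExtraGeneralizedArithmetical {p} (a h k : ℕ) (d : ℤ) (S : Pred ℕ p) : Set p where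
  field
    isNumericalSemigroup : IsNumericalSemigroup S
    generated            : S ≐ (λ n → + n ∈ ⟨ generators a h k d ⟩)
    1≤a                  : 1 ℕ.≤ a
    1≤h                  : 1 ℕ.≤ h
    1≤k                  : 1 ℕ.≤ k
    k<a                  : k ℕ.< a
    gcd≡1                : gcd (+ a) d ≡ + 1
    a<ah+kd              : + a ℤ.< + (a ℕ.* h) ℤ.+ + k ℤ.* d

-- Totally ordered fields, standing in for ℝ: the library has no real numbers, and
-- cones, faces and dimensions below use only the ordered field structure.
record OrderedField c ℓ₁ ℓ₂ : Set (lsuc (c ⊔ ℓ₁ ⊔ ℓ₂)) where
  infix  8 -_
  infixl 7 _*_
  infixl 6 _+_
  infix  4 _≈_ _<_
  field
    Carrier            : Set c
    _≈_                : Rel Carrier ℓ₁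
    _<_                : Rel Carrier ℓ₂
    _+_ _*_            : Carrier → Carrier → Carrier
    -_                 : Carrier → Carrier
    0# 1#              : Carrier
    isCommutativeRing  : IsCommutativeRing _≈_ _+_ _*_ -_ 0# 1#
    isStrictTotalOrder : IsStrictTotalOrder _≈_ _<_
    0<1                : 0# < 1#
    inverse            : ∀ x → ¬ (x ≈ 0#) → ∃[ y ] (x * y ≈ 1#)
    +-monoˡ-<          : ∀ z {x y} → x < y → x + z < y + z
    *-pos              : ∀ {x y} → 0# < x → 0# < y → 0# < x * y

  commutativeRing : CommutativeRing c ℓ₁
  commutativeRing = record { isCommutativeRing = isCommutativeRing }

  open CommutativeRing commutativeRing public using (_-_; semiring)
  open Algebra.Properties.Semiring.Sum semiring public using (sum)
  open Algebra.Properties.Semiring.Mult semiring public using () renaming (_×_ to _×#_)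
  open Relation.Binary.Construct.StrictToNonStrict _≈_ _<_ public using (_≤_)

module _ {c ℓ₁ ℓ₂} (K : OrderedField c ℓ₁ ℓ₂) where
  open OrderedField K

  Point : ℕ → Set c
  Point n = Vector Carrier n

  fromℕ : ℕ → Carrier
  fromℕ n = n ×# 1#

  module _ {n : ℕ} where

    dot : Point n → Point n → Carrier
    dot u x = sum (λ i → u i * x i)

    IsAffineCombination : ∀ {r} → Vector (Point n) r → Pred (Point n) _
    IsAffineCombination {r} v x =
      Σ[ t ∈ Vector Carrier r ]
        (sum t ≈ 1# × (∀ i → x i ≈ sum (λ j → t j * v j i)))

    AffineSpan : ∀ {q} → Pred (Point n) q → Pred (Point n) _
    AffineSpan F x =
      ∃[ r ] Σ[ v ∈ Vector (Point n) r ] ((∀ j → v j ∈ F) × IsAffineCombination v x)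

    AffinelyIndependent : ∀ {r} → Vector (Point n) r → Set _
    AffinelyIndependent {r} v =
      (t : Vector Carrier r) → sum t ≈ 0# → (∀ i → sum (λ j → t j * v j i) ≈ 0#) →
      ∀ j → t j ≈ 0#

    -- The affine span of F has an affine basis consisting of e + 1 points.
    HasDimension : ∀ {q} → Pred (Point n) q → ℕ → Set _
    HasDimension F e =
      Σ[ v ∈ Vector (Point n) (ℕ.suc e) ]
        ( AffinelyIndependent v
        × (∀ j → v j ∈ AffineSpan F)
        × (∀ {x} → x ∈ AffineSpan F → IsAffineCombination v x))

    -- The interior of F in its affine span, using balls of the maximum norm.
    RelativeInterior : ∀ {q} → Pred (Point n) q → Pred (Point n) _
    RelativeInterior F x =
      x ∈ F × ∃[ ε ] (0# < ε ×
        (∀ {y} → y ∈ AffineSpan F → (∀ i → y i - x i < ε × x i - y i < ε) → y ∈ F))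

    -- Faces are the sets cut out by valid inequalities; P itself and ∅ are faces.
    IsFace : ∀ {q r} → Pred (Point n) q → Pred (Point n) r → Set _
    IsFace P F =
      Σ[ u ∈ Point n ] ∃[ b ]
        ((∀ {x} → x ∈ P → b ≤ dot u x) × F ≐ (P ∩ (λ x → dot u x ≈ b)))

  -- Since residue l ≠ 0, the premise forces residue i + residue j ≢ 0 modulo m.
  GroupCone : (m : ℕ) .{{_ : NonZero m}} → Pred (Point (m ∸ 1)) _
  GroupCone m x =
    ∀ i j l → (residue i ℕ.+ residue j) % m ≡ residue l → x l ≤ x i + x j

  FaceContains : ∀ {p q} (m : ℕ) .{{_ : NonZero m}} →
                 Pred (Point (m ∸ 1)) q → Pred ℕ p → Set _
  FaceContains m F S =
    m ∈ S × ∃[ w ] (IsApéryTuple S m w × (λ i → fromℕ (w i)) ∈ RelativeInterior F)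

{-# OPTIONS --safe #-}
module Submission where

open import Defs
open import Algebra.Bundles using (CommutativeRing)
import Algebra.Properties.Ring
import Algebra.Properties.Semiring.Mult
import Algebra.Properties.Semiring.Sum
import Algebra.Solver.Ring
open import Algebra.Solver.Ring.AlmostCommutativeRing
  using (fromCommutativeRing; _-Raw-AlmostCommutative⟶_)
open import Data.Empty using (⊥; ⊥-elim)
open import Data.Fin.Base as Fin using (Fin; zero; suc; toℕ; fromℕ<)
open import Data.Fin.Properties using (toℕ<n; toℕ-fromℕ; toℕ-fromℕ<; toℕ-injective)
open import Data.Integer.Base as ℤ using (ℤ; +_; -[1+_])
open import Data.Integer.DivMod using (_%ℕ_; _/ℕ_; n%ℕd<d; a≡a%ℕn+[a/ℕn]*n)
open import Data.Integer.GCD using (gcd)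
import Data.Integer.Properties as ℤ
import Data.Integer.Solver
open import Data.Maybe.Base using (Maybe; just; nothing)
open import Data.Nat.Base as ℕ
  using (ℕ; zero; suc; z≤n; s≤s; _∸_; _%_; _/_; NonZero; ⌊_/2⌋; ⌈_/2⌉)
open import Data.Nat.Coprimality using (gcd≡1⇒coprime; coprime-Bézout)
open import Data.Nat.Divisibility using (∣-refl)
open import Data.Nat.DivMod
  using ( m%n<n; m≡m%n+[m/n]*n; m<n*o⇒m/o<n; m/n*n≤m; [m+kn]%n≡m%n; m<n⇒m%n≡m
        ; n/n≡1; n/1≡n; m<n⇒m/n≡0; +-distrib-/-∣ʳ)
open import Data.Nat.GCD using (module Bézout)
import Data.Nat.Properties as ℕ
open import Data.Product.Base using (∃-syntax; _×_; _,_; proj₁; proj₂)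
import Data.Sign.Base as Sign
open import Data.Sum.Base using (_⊎_; inj₁; inj₂)
open import Data.Vec.Functional using (Vector; removeAt; _∷_; [])
open import Level using (_⊔_)
import Relation.Binary.Construct.StrictToNonStrict
open import Relation.Binary.Definitions using (tri<; tri≈; tri>)
open import Relation.Binary.PropositionalEquality as ≡ using (_≡_)
open import Relation.Binary.Structures using (IsStrictTotalOrder)
open import Relation.Nullary.Decidable.Core using (yes; no)
open import Relation.Nullary.Negation.Core using (¬_; contradiction)
open import Relation.Unary using (Pred; _∈_; _⊆_; _∩_)

-- Let c(s) = ⌈s/k⌉.  The element of Ap(S; a) in the class of sd, 1 ≤ s < a, is
-- c(s)ah + sd: minimality of ah + d forces ⌊a/k⌋h + d > 0, so that replacing s by s + ta only
-- increases this value.  For the same reason the tight inequalities x_i + x_j ≥ x_l at the Apéry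
-- tuple are exactly those whose indices s, t, u (with i = sd, j = td, l = ud) satisfy s + t = u
-- without reduction modulo a and c(s) + c(t) = c(u).  Since the tuple is relatively interior to F,
-- the affine span of F is the linear space of solutions of the tight equations, i.e. the space of
-- functions on 1, …, a - 1 that are additive wherever c is.  Such a function is determined by its
-- values at 1, …, e, where e is the claimed dimension, and these values are arbitrary.

-- Division by d unrolls the cyclic index set into the interval 1, ..., a - 1. One identity then
-- serves both arithmetic claims. With q = ⌊a/k⌋, an expression that uses b copies of a, e
-- generators more than necessary and t wraps modulo a exceeds the value c(s)ah + sd of its reduced
-- class by (b + eh + t(qh + d))a. Since d may be negative, everything hinges on qh + d > 0: then a
-- vanishing excess kills each summand. The excess vanishes for an Apéry element by minimality in
-- its class, and for a relation by tightness.
--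
-- The shape of the solution space depends on how far the interval reaches beyond k. If it ends at
-- k, all ceilings are 1 and no relation exists. If it ends at k + 1, only that one sum carries
-- relations, which pair s with k + 1 - s. If it contains k + 2 as well, two neighbouring sums can
-- be compared; for k > 1 this leaves the two parameters of an arithmetic progression, spanned by
-- c(s) and s. For k = 1 these two solutions coincide.

module NumericalSemigroups where
  open ≡ using (refl; sym; trans; cong; cong₂; subst; module ≡-Reasoning)
  open import Data.Nat.Base using (_≤_; _<_)
  open Data.Integer.Solver.+-*-Solver
  open Algebra.Properties.Semiring.Sum ℤ.+-*-semiring
    using (sum; sum-cong-≗; *-distribˡ-sum; ∑-distrib-+; sum-replicate-zero)

  -- Ceilings of quotients

  -- The divisor is suc k: throughout, the integer k of the theorem is written suc k.
  ⌈_/1+_⌉ : ℕ → ℕ → ℕ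
  ⌈ s /1+ k ⌉ = (s ℕ.+ k) / suc k

  module _ {k : ℕ} where
    private
      c : ℕ → ℕ
      c s = ⌈ s /1+ k ⌉

    -- Together with `⌈/⌉-upper` this characterises the ceiling as the least `n` with
    -- `s ≤ n * suc k`; the shift bound and subadditivity below rest on these two facts alone.
    ⌈/⌉-least : ∀ {s n} → s ≤ n ℕ.* suc k → c s ≤ n
    ⌈/⌉-least {s} {n} s≤ = ℕ.≤-pred (m<n*o⇒m/o<n {s ℕ.+ k} {suc n} {suc k}
      (subst (s ℕ.+ k <_) (ℕ.+-comm (n ℕ.* suc k) (suc k)) (ℕ.+-mono-≤-< s≤ (ℕ.n<1+n k))))

    ⌈/⌉-upper : ∀ s → s ≤ c s ℕ.* suc k
    ⌈/⌉-upper s = ℕ.+-cancelʳ-≤ k s _ (begin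
      s ℕ.+ k                                   ≡⟨ m≡m%n+[m/n]*n (s ℕ.+ k) (suc k) ⟩
      (s ℕ.+ k) % suc k ℕ.+ c s ℕ.* suc k       ≤⟨ ℕ.+-monoˡ-≤ _ (ℕ.≤-pred (m%n<n (s ℕ.+ k) (suc k))) ⟩
      k ℕ.+ c s ℕ.* suc k                       ≡⟨ ℕ.+-comm k _ ⟩
      c s ℕ.* suc k ℕ.+ k                       ∎)
      where open ℕ.≤-Reasoning

    ⌈/⌉-suc : ∀ s → c (suc s) ≡ suc (s / suc k)
    ⌈/⌉-suc s = begin
      (suc s ℕ.+ k) / suc k             ≡⟨ cong (_/ suc k) (ℕ.+-suc s k) ⟨
      (s ℕ.+ suc k) / suc k             ≡⟨ +-distrib-/-∣ʳ s (∣-refl {suc k}) ⟩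
      s / suc k ℕ.+ suc k / suc k       ≡⟨ cong (s / suc k ℕ.+_) (n/n≡1 (suc k)) ⟩
      s / suc k ℕ.+ 1                   ≡⟨ ℕ.+-comm _ 1 ⟩
      suc (s / suc k)                   ∎
      where open ≡-Reasoning

    -- Since `a` is at least `(a / suc k) * suc k`, removing `t * (a / suc k)` blocks from a cover
    -- of `s + t * a` still leaves a cover of `s`.
    ⌈/⌉-+* : ∀ s t a → c s ℕ.+ t ℕ.* (a / suc k) ≤ c (s ℕ.+ t ℕ.* a)
    ⌈/⌉-+* s t a = ℕ.m≤o∸n⇒m+n≤o (c s) tq≤N (⌈/⌉-least (begin
      s                                          ≤⟨ ℕ.m+n≤o⇒m≤o∸n s s+tqk≤ ⟩
      N ℕ.* suc k ∸ t ℕ.* q ℕ.* suc k            ≡⟨ ℕ.*-distribʳ-∸ (suc k) N (t ℕ.* q) ⟨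
      (N ∸ t ℕ.* q) ℕ.* suc k                    ∎))
      where
      open ℕ.≤-Reasoning
      q = a / suc k
      N = c (s ℕ.+ t ℕ.* a)
      s+tqk≤ : s ℕ.+ t ℕ.* q ℕ.* suc k ≤ N ℕ.* suc k
      s+tqk≤ = begin
        s ℕ.+ t ℕ.* q ℕ.* suc k   ≡⟨ cong (s ℕ.+_) (ℕ.*-assoc t q (suc k)) ⟩
        s ℕ.+ t ℕ.* (q ℕ.* suc k) ≤⟨ ℕ.+-monoʳ-≤ s (ℕ.*-monoʳ-≤ t (m/n*n≤m a (suc k))) ⟩
        s ℕ.+ t ℕ.* a             ≤⟨ ⌈/⌉-upper (s ℕ.+ t ℕ.* a) ⟩
        N ℕ.* suc k               ∎
      tq≤N : t ℕ.* q ≤ N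
      tq≤N = ℕ.*-cancelʳ-≤ (t ℕ.* q) N (suc k) (ℕ.≤-trans (ℕ.m≤n+m _ s) s+tqk≤)

    ⌈/⌉-subadditive : ∀ s t → c (s ℕ.+ t) ≤ c s ℕ.+ c t
    ⌈/⌉-subadditive s t = ⌈/⌉-least (ℕ.≤-trans (ℕ.+-mono-≤ (⌈/⌉-upper s) (⌈/⌉-upper t))
      (ℕ.≤-reflexive (sym (ℕ.*-distribʳ-+ (suc k) (c s) (c t)))))

  ⌈/⌉-small : ∀ {k s} → 1 ≤ s → s ≤ suc k → ⌈ s /1+ k ⌉ ≡ 1
  ⌈/⌉-small {k} {suc s} _ s<k = trans (⌈/⌉-suc {k} s) (cong suc (m<n⇒m/n≡0 s<k))

  ⌈/⌉-+ : ∀ k s → ⌈ s ℕ.+ suc k /1+ k ⌉ ≡ suc ⌈ s /1+ k ⌉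
  ⌈/⌉-+ k s = begin
    (s ℕ.+ suc k ℕ.+ k) / suc k             ≡⟨ cong (_/ suc k) (trans (ℕ.+-assoc s (suc k) k) (trans (cong (s ℕ.+_) (ℕ.+-comm (suc k) k)) (sym (ℕ.+-assoc s k (suc k))))) ⟩
    (s ℕ.+ k ℕ.+ suc k) / suc k             ≡⟨ +-distrib-/-∣ʳ (s ℕ.+ k) (∣-refl {suc k}) ⟩
    ⌈ s /1+ k ⌉ ℕ.+ suc k / suc k           ≡⟨ cong (⌈ s /1+ k ⌉ ℕ.+_) (n/n≡1 (suc k)) ⟩
    ⌈ s /1+ k ⌉ ℕ.+ 1                       ≡⟨ ℕ.+-comm _ 1 ⟩
    suc ⌈ s /1+ k ⌉                         ∎
    where open ≡-Reasoning

  -- Nonnegative combinations of generators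

  module _ {n} (g : Vector ℤ n) where
    open ≡-Reasoning
    ⟨⟩-+ : ∀ {x y} → x ∈ ⟨ g ⟩ → y ∈ ⟨ g ⟩ → x ℤ.+ y ∈ ⟨ g ⟩
    ⟨⟩-+ {x} {y} (b , x≡) (c , y≡) = (λ i → b i ℕ.+ c i) , (begin
      x ℤ.+ y
        ≡⟨ cong₂ ℤ._+_ x≡ y≡ ⟩
      sum (λ i → + b i ℤ.* g i) ℤ.+ sum (λ i → + c i ℤ.* g i)
        ≡⟨ ∑-distrib-+ (λ i → + b i ℤ.* g i) (λ i → + c i ℤ.* g i) ⟨
      sum (λ i → + b i ℤ.* g i ℤ.+ + c i ℤ.* g i)
        ≡⟨ sum-cong-≗ (λ i → sym (trans (cong (ℤ._* g i) (ℤ.pos-+ (b i) (c i))) (ℤ.*-distribʳ-+ (g i) (+ b i) (+ c i)))) ⟩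
      sum (λ i → + (b i ℕ.+ c i) ℤ.* g i) ∎)

    ⟨⟩-* : ∀ m {x} → x ∈ ⟨ g ⟩ → + m ℤ.* x ∈ ⟨ g ⟩
    ⟨⟩-* m {x} (c , x≡) = (λ i → m ℕ.* c i) , (begin
      + m ℤ.* x                               ≡⟨ cong (+ m ℤ.*_) x≡ ⟩
      + m ℤ.* sum (λ i → + c i ℤ.* g i)       ≡⟨ *-distribˡ-sum (+ m) (λ i → + c i ℤ.* g i) ⟩
      sum (λ i → + m ℤ.* (+ c i ℤ.* g i))
        ≡⟨ sum-cong-≗ (λ i → sym (trans (cong (ℤ._* g i) (ℤ.pos-* m (c i))) (ℤ.*-assoc (+ m) (+ c i) (g i)))) ⟩
      sum (λ i → + (m ℕ.* c i) ℤ.* g i)       ∎)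

  generator∈⟨⟩ : ∀ {n} (g : Vector ℤ n) i → g i ∈ ⟨ g ⟩
  generator∈⟨⟩ g i = (λ j → single j i) , sym (expand g i)
    where
    single : ∀ {n} → Fin n → Fin n → ℕ
    single zero    zero    = 1
    single zero    (suc _) = 0
    single (suc _) zero    = 0
    single (suc j) (suc i) = single j i
    open ≡-Reasoning
    expand : ∀ {n} (g : Vector ℤ n) i → sum (λ j → + single j i ℤ.* g j) ≡ g i
    expand {suc n} g zero = begin
      + 1 ℤ.* g zero ℤ.+ sum (λ j → + 0 ℤ.* g (suc j))
        ≡⟨ cong₂ ℤ._+_ (ℤ.*-identityˡ (g zero)) (trans (sum-cong-≗ (λ j → ℤ.*-zeroˡ (g (suc j)))) (sum-replicate-zero n)) ⟩
      g zero ℤ.+ + 0  ≡⟨ ℤ.+-identityʳ _ ⟩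
      g zero          ∎
    expand {suc n} g (suc i) = begin
      + 0 ℤ.* g zero ℤ.+ sum (λ j → + single j i ℤ.* g (suc j))
        ≡⟨ cong₂ ℤ._+_ (ℤ.*-zeroˡ (g zero)) (expand (λ j → g (suc j)) i) ⟩
      + 0 ℤ.+ g (suc i)  ≡⟨ ℤ.+-identityˡ _ ⟩
      g (suc i)          ∎

  -- Positivity of the slope qh + d

  0<⇒+suc : ∀ {i} → + 0 ℤ.< i → ∃[ n ] i ≡ + suc n
  0<⇒+suc {+ suc n} _ = n , refl
  0<⇒+suc {+ zero} (ℤ.+<+ ())

  -- The nonpositive case is delivered as the negative of a natural number because that number
  -- becomes the coefficient of the generator a in a forbidden combination.
  sign-cases : ∀ i → (∃[ n ] i ≡ + suc n) ⊎ (∃[ n ] i ≡ ℤ.- + n)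
  sign-cases (+ zero)  = inj₂ (0 , refl)
  sign-cases (+ suc n) = inj₁ (n , refl)
  sign-cases -[1+ n ]  = inj₂ (suc n , refl)

  -+≢+suc : ∀ {m n} → ℤ.- + m ≡ + suc n → ⊥
  -+≢+suc {zero} ()
  -+≢+suc {suc m} ()

  *-nonNeg-cancel : ∀ m {i n} → + suc m ℤ.* i ≡ + n → ∃[ l ] i ≡ + l
  *-nonNeg-cancel m {+ l} _ = l , refl

  -- If the slope were not positive, then with a = r + q k the generator ah + d would be
  -- a combination of a, ah + kd and ah + (r+1)d.
  slope-positive : ∀ a h k d →
    + a ℤ.< + (a ℕ.* h) ℤ.+ + suc k ℤ.* d →
    IsMinimalGeneratingFamily (generators a h (suc k) d) →
    ∃[ n ] + (a / suc k) ℤ.* + h ℤ.+ d ≡ + suc n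
  slope-positive a h k d a< minimal with sign-cases (+ (a / suc k) ℤ.* + h ℤ.+ d)
  ... | inj₁ pos = pos
  ... | inj₂ (V , slope≡) with a % suc k | m%n<n a (suc k) | m≡m%n+[m/n]*n a (suc k)
  -- Here `suc k` divides `a`, so `suc k` times the slope equals ah + kd for the theorem's k, which
  -- is positive.
  ... | zero | _ | a≡ = ⊥-elim (-+≢+suc absurd)
    where
    open ≡-Reasoning
    q = a / suc k
    positive = 0<⇒+suc (ℤ.≤-<-trans (ℤ.+≤+ z≤n) a<)
    absurd : ℤ.- + (suc k ℕ.* V) ≡ + suc (proj₁ positive)
    absurd = begin
      ℤ.- + (suc k ℕ.* V)                      ≡⟨ cong ℤ.-_ (ℤ.pos-* (suc k) V) ⟩
      ℤ.- (+ suc k ℤ.* + V)                    ≡⟨ ℤ.neg-distribʳ-* (+ suc k) (+ V) ⟩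
      + suc k ℤ.* (ℤ.- + V)                    ≡⟨ cong (+ suc k ℤ.*_) slope≡ ⟨
      + suc k ℤ.* (+ q ℤ.* + h ℤ.+ d)
        ≡⟨ solve 4 (λ k q h d → k :* (q :* h :+ d) := q :* k :* h :+ k :* d) refl (+ suc k) (+ q) (+ h) d ⟩
      + q ℤ.* + suc k ℤ.* + h ℤ.+ + suc k ℤ.* d
        ≡⟨ cong (λ x → x ℤ.* + h ℤ.+ + suc k ℤ.* d) (trans (cong +_ a≡) (ℤ.pos-* q (suc k))) ⟨
      + a ℤ.* + h ℤ.+ + suc k ℤ.* d            ≡⟨ cong (ℤ._+ + suc k ℤ.* d) (ℤ.pos-* a h) ⟨
      + (a ℕ.* h) ℤ.+ + suc k ℤ.* d            ≡⟨ proj₂ positive ⟩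
      + suc (proj₁ positive)                   ∎
  slope-positive a h (suc k) d a< minimal | inj₂ (V , slope≡) | suc r | s≤s r<k | a≡ =
    contradiction (subst (_∈ ⟨ g ⟩) combination
      (⟨⟩-+ g (⟨⟩-+ g (⟨⟩-* g V (generator∈⟨⟩ g zero)) (⟨⟩-* g q (generator∈⟨⟩ g (suc (Fin.fromℕ k)))))
              (generator∈⟨⟩ g (suc (fromℕ< r<k)))))
      (minimal (suc zero))
    where
    open ≡-Reasoning
    q = a / suc (suc k)
    K = + suc (suc k)
    R = + suc r
    H = + (a ℕ.* h)
    g = removeAt (generators a h (suc (suc k)) d) (suc zero)
    V≡ : + V ≡ ℤ.- (+ q ℤ.* + h ℤ.+ d)
    V≡ = trans (sym (ℤ.neg-involutive (+ V))) (cong ℤ.-_ (sym slope≡))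
    A≡ : + a ≡ R ℤ.+ + q ℤ.* K
    A≡ = trans (cong +_ a≡) (cong (λ x → R ℤ.+ x) (ℤ.pos-* q (suc (suc k))))
    combination : + V ℤ.* + a ℤ.+ + q ℤ.* (H ℤ.+ + (suc (suc (toℕ (Fin.fromℕ k)))) ℤ.* d)
                  ℤ.+ (H ℤ.+ + (suc (suc (toℕ (fromℕ< r<k)))) ℤ.* d) ≡ H ℤ.+ + 1 ℤ.* d
    combination = begin
      + V ℤ.* + a ℤ.+ + q ℤ.* (H ℤ.+ + (suc (suc (toℕ (Fin.fromℕ k)))) ℤ.* d)
        ℤ.+ (H ℤ.+ + (suc (suc (toℕ (fromℕ< r<k)))) ℤ.* d)
        ≡⟨ cong₂ (λ x y → + V ℤ.* + a ℤ.+ + q ℤ.* (H ℤ.+ + (suc (suc x)) ℤ.* d) ℤ.+ (H ℤ.+ + (suc (suc y)) ℤ.* d))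
             (toℕ-fromℕ k) (toℕ-fromℕ< r<k) ⟩
      + V ℤ.* + a ℤ.+ + q ℤ.* (H ℤ.+ K ℤ.* d) ℤ.+ (H ℤ.+ (+ 1 ℤ.+ R) ℤ.* d)
        ≡⟨ cong₂ (λ x y → x ℤ.* + a ℤ.+ + q ℤ.* (y ℤ.+ K ℤ.* d) ℤ.+ (H ℤ.+ (+ 1 ℤ.+ R) ℤ.* d)) V≡ (ℤ.pos-* a h) ⟩
      (ℤ.- (+ q ℤ.* + h ℤ.+ d)) ℤ.* + a ℤ.+ + q ℤ.* (+ a ℤ.* + h ℤ.+ K ℤ.* d) ℤ.+ (H ℤ.+ (+ 1 ℤ.+ R) ℤ.* d)
        -- The products with `h` cancel, and all that remains besides ah + d is the multiple (r + qk
        -- - a)d, which vanishes by the Euclidean division `A≡`.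
        ≡⟨ solve 7 (λ a q h d k y r → (:- (q :* h :+ d)) :* a :+ q :* (a :* h :+ k :* d) :+ (y :+ (con (+ 1) :+ r) :* d)
                    := y :+ con (+ 1) :* d :+ (r :+ q :* k :- a) :* d) refl (+ a) (+ q) (+ h) d K H R ⟩
      H ℤ.+ + 1 ℤ.* d ℤ.+ (R ℤ.+ + q ℤ.* K ℤ.- + a) ℤ.* d
        ≡⟨ cong (λ x → H ℤ.+ + 1 ℤ.* d ℤ.+ (x ℤ.- + a) ℤ.* d) (sym A≡) ⟩
      H ℤ.+ + 1 ℤ.* d ℤ.+ (+ a ℤ.- + a) ℤ.* d
        ≡⟨ solve 3 (λ a y d → y :+ (a :- a) :* d := y) refl (+ a) (H ℤ.+ + 1 ℤ.* d) d ⟩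
      H ℤ.+ + 1 ℤ.* d ∎

  -- Abstract so that type checking does not unfold the extended Euclidean algorithm.
  abstract
    bézout : ∀ a d → gcd (+ a) d ≡ + 1 → ∃[ α ] ∃[ β ] α ℤ.* + a ℤ.+ β ℤ.* d ≡ + 1
    bézout a d gcd≡1 with multiple d
      where
      multiple : ∀ d → ∃[ u ] + ℤ.∣ d ∣ ≡ u ℤ.* d
      multiple (+ n)    = + 1 , sym (ℤ.*-identityˡ (+ n))
      multiple -[1+ n ] = -[1+ 0 ] , sym (ℤ.-1*i≡-i -[1+ n ])
    ... | u , ∣d∣≡ with coprime-Bézout (gcd≡1⇒coprime {a} {ℤ.∣ d ∣} (ℤ.+-injective gcd≡1))
    ... | Bézout.+- x y eq = + x , ℤ.- (+ y ℤ.* u) , (begin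
      + x ℤ.* + a ℤ.+ ℤ.- (+ y ℤ.* u) ℤ.* d
        ≡⟨ solve 4 (λ x y u d → x :+ (:- (y :* u)) :* d := x :- y :* (u :* d)) refl (+ x ℤ.* + a) (+ y) u d ⟩
      + x ℤ.* + a ℤ.- + y ℤ.* (u ℤ.* d)
        ≡⟨ cong₂ (λ p q → p ℤ.- + y ℤ.* q) (trans (sym (ℤ.pos-* x a)) (cong +_ (sym eq))) (sym ∣d∣≡) ⟩
      + (1 ℕ.+ y ℕ.* ℤ.∣ d ∣) ℤ.- + y ℤ.* + ℤ.∣ d ∣
        ≡⟨ cong (λ p → + 1 ℤ.+ p ℤ.- + y ℤ.* + ℤ.∣ d ∣) (ℤ.pos-* y ℤ.∣ d ∣) ⟩
      + 1 ℤ.+ + y ℤ.* + ℤ.∣ d ∣ ℤ.- + y ℤ.* + ℤ.∣ d ∣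
        ≡⟨ solve 1 (λ p → con (+ 1) :+ p :- p := con (+ 1)) refl (+ y ℤ.* + ℤ.∣ d ∣) ⟩
      + 1 ∎)
      where open ≡-Reasoning
    ... | Bézout.-+ x y eq = ℤ.- + x , + y ℤ.* u , (begin
      ℤ.- + x ℤ.* + a ℤ.+ + y ℤ.* u ℤ.* d
        ≡⟨ solve 5 (λ x a y u d → (:- x) :* a :+ y :* u :* d := y :* (u :* d) :- x :* a) refl (+ x) (+ a) (+ y) u d ⟩
      + y ℤ.* (u ℤ.* d) ℤ.- + x ℤ.* + a
        ≡⟨ cong (λ q → q ℤ.- + x ℤ.* + a) (trans (cong (+ y ℤ.*_) (sym ∣d∣≡)) (trans (sym (ℤ.pos-* y ℤ.∣ d ∣)) (cong +_ (sym eq)))) ⟩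
      + (1 ℕ.+ x ℕ.* a) ℤ.- + x ℤ.* + a
        ≡⟨ cong (λ p → + 1 ℤ.+ p ℤ.- + x ℤ.* + a) (ℤ.pos-* x a) ⟩
      + 1 ℤ.+ + x ℤ.* + a ℤ.- + x ℤ.* + a
        ≡⟨ solve 1 (λ p → con (+ 1) :+ p :- p := con (+ 1)) refl (+ x ℤ.* + a) ⟩
      + 1 ∎)
      where open ≡-Reasoning

  -- Congruences modulo a

  module Congruence (a : ℕ) where
    infix 4 _≈ₐ_
    record _≈ₐ_ (x y : ℤ) : Set where
      constructor shift
      field
        multiple : ℤ
        equality : x ≡ y ℤ.+ multiple ℤ.* + a

    ≈ₐ-sym : ∀ {x y} → x ≈ₐ y → y ≈ₐ x
    ≈ₐ-sym {x} {y} (shift t refl) = shift (ℤ.- t)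
      (solve 3 (λ y t a → y := y :+ t :* a :+ (:- t) :* a) refl y t (+ a))

    ≈ₐ-trans : ∀ {x y z} → x ≈ₐ y → y ≈ₐ z → x ≈ₐ z
    ≈ₐ-trans {z = z} (shift t refl) (shift u refl) = shift (t ℤ.+ u)
      (solve 4 (λ z t u a → z :+ u :* a :+ t :* a := z :+ (t :+ u) :* a) refl z t u (+ a))

    ≈ₐ-+ : ∀ {x y z w} → x ≈ₐ y → z ≈ₐ w → x ℤ.+ z ≈ₐ y ℤ.+ w
    ≈ₐ-+ {y = y} {w = w} (shift t refl) (shift u refl) = shift (t ℤ.+ u)
      (solve 5 (λ y w t u a → y :+ t :* a :+ (w :+ u :* a) := y :+ w :+ (t :+ u) :* a) refl y w t u (+ a))

    ≈ₐ-*ʳ : ∀ {x y} z → x ≈ₐ y → x ℤ.* z ≈ₐ y ℤ.* z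
    ≈ₐ-*ʳ {y = y} z (shift t refl) = shift (t ℤ.* z)
      (solve 4 (λ y t z a → (y :+ t :* a) :* z := y :* z :+ t :* z :* a) refl y t z (+ a))

    ≈ₐ-%ℕ : ∀ x .{{_ : NonZero a}} → x ≈ₐ + (x %ℕ a)
    ≈ₐ-%ℕ x = shift (x /ℕ a) (a≡a%ℕn+[a/ℕn]*n x a)

    -- As `s` is already reduced, a natural number of its class cannot lie below it: a negative
    -- multiple would give `a ≤ s`.
    ≈ₐ⇒≡+* : ∀ {M s} → + M ≈ₐ + s → s < a → ∃[ t ] M ≡ s ℕ.+ t ℕ.* a
    ≈ₐ⇒≡+* {M} {s} (shift (+ t) eq) _ = t , ℤ.+-injective (trans eq (cong (λ x → + s ℤ.+ x) (sym (ℤ.pos-* t a))))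
    ≈ₐ⇒≡+* {M} {s} (shift -[1+ t ] eq) s<a = contradiction s<a (ℕ.≤⇒≯ (begin
      a                        ≤⟨ ℕ.m≤m+n a _ ⟩
      suc t ℕ.* a              ≤⟨ ℕ.m≤n+m _ M ⟩
      M ℕ.+ suc t ℕ.* a        ≡⟨ ℤ.+-injective M+≡ ⟩
      s                        ∎))
      where
      open ℕ.≤-Reasoning
      M+≡ : + (M ℕ.+ suc t ℕ.* a) ≡ + s
      M+≡ = trans (cong₂ (λ x y → x ℤ.+ y) eq (ℤ.pos-* (suc t) a))
        (solve 3 (λ s t a → s :+ (:- t) :* a :+ t :* a := s) refl (+ s) (+ suc t) (+ a))

    ≈ₐ⇒≡ : ∀ {s t} → + s ≈ₐ + t → s < a → t < a → s ≡ t
    ≈ₐ⇒≡ {s} {t} s≈t s<a t<a with ≈ₐ⇒≡+* s≈t t<a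
    ... | zero  , eq = trans eq (ℕ.+-identityʳ t)
    ... | suc u , eq = contradiction s<a (ℕ.≤⇒≯ (ℕ.≤-trans (ℕ.m≤m+n a (u ℕ.* a))
          (ℕ.≤-trans (ℕ.m≤n+m _ t) (ℕ.≤-reflexive (sym eq)))))

    -- Multiply x - y by αa + βd = 1: the first part is a multiple of `a`, and the second is β times
    -- the given difference xd - yd.
    ≈ₐ-*-cancelʳ : ∀ {d α β} → α ℤ.* + a ℤ.+ β ℤ.* d ≡ + 1 → ∀ {x y} → x ℤ.* d ≈ₐ y ℤ.* d → x ≈ₐ y
    ≈ₐ-*-cancelʳ {d} {α} {β} αa+βd≡1 {x} {y} (shift t eq) = shift ((x ℤ.- y) ℤ.* α ℤ.+ β ℤ.* t) (begin
      x
        ≡⟨ solve 2 (λ x y → x := y :+ (x :- y) :* con (+ 1)) refl x y ⟩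
      y ℤ.+ (x ℤ.- y) ℤ.* + 1
        ≡⟨ cong (λ o → y ℤ.+ (x ℤ.- y) ℤ.* o) αa+βd≡1 ⟨
      y ℤ.+ (x ℤ.- y) ℤ.* (α ℤ.* + a ℤ.+ β ℤ.* d)
        ≡⟨ solve 6 (λ x y α a β d → y :+ (x :- y) :* (α :* a :+ β :* d) :=
                     y :+ ((x :- y) :* α :* a :+ β :* (x :* d :- y :* d))) refl x y α (+ a) β d ⟩
      y ℤ.+ ((x ℤ.- y) ℤ.* α ℤ.* + a ℤ.+ β ℤ.* (x ℤ.* d ℤ.- y ℤ.* d))
        ≡⟨ cong (λ z → y ℤ.+ ((x ℤ.- y) ℤ.* α ℤ.* + a ℤ.+ β ℤ.* (z ℤ.- y ℤ.* d))) eq ⟩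
      y ℤ.+ ((x ℤ.- y) ℤ.* α ℤ.* + a ℤ.+ β ℤ.* (y ℤ.* d ℤ.+ t ℤ.* + a ℤ.- y ℤ.* d))
        ≡⟨ solve 7 (λ x y α a β z t → y :+ ((x :- y) :* α :* a :+ β :* (z :+ t :* a :- z)) :=
                     y :+ ((x :- y) :* α :+ β :* t) :* a) refl x y α (+ a) β (y ℤ.* d) t ⟩
      y ℤ.+ ((x ℤ.- y) ℤ.* α ℤ.+ β ℤ.* t) ℤ.* + a ∎)
      where open ≡-Reasoning

  -- The excess formula. Replacing `s` by `s + t * A` while paying `t * q` further copies of `H`
  -- costs `t * V` multiples of `A`, each surplus copy of `H` costs `h` of them, and `b` counts
  -- copies of `A` itself. In its uses these coefficients are nonnegative and `V` is positive.
  shift-identity : ∀ A h q d H V → H ≡ A ℤ.* h → q ℤ.* h ℤ.+ d ≡ V → ∀ b e c t s →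
    b ℤ.* A ℤ.+ ((e ℤ.+ (c ℤ.+ t ℤ.* q)) ℤ.* H ℤ.+ (s ℤ.+ t ℤ.* A) ℤ.* d) ≡
    c ℤ.* H ℤ.+ s ℤ.* d ℤ.+ (b ℤ.+ e ℤ.* h ℤ.+ t ℤ.* V) ℤ.* A
  shift-identity A h q d H V refl refl b e c t s =
    solve 9 (λ A h q d b e c t s →
        b :* A :+ ((e :+ (c :+ t :* q)) :* (A :* h) :+ (s :+ t :* A) :* d) :=
        c :* (A :* h) :+ s :* d :+ (b :+ e :* h :+ t :* (q :* h :+ d)) :* A)
      refl A h q d b e c t s

  -- The Apéry set and its tight relations

  module ApérySet {p} (a h k : ℕ) .{{_ : NonZero a}} (d : ℤ) (S : Pred ℕ p)
    (arithmetical : IsExtraGeneralizedArithmetical a h (suc k) d S)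
    (minimal : IsMinimalGeneratingFamily (generators a h (suc k) d)) where

    open IsExtraGeneralizedArithmetical arithmetical

    private
      A = + a
      q = a / suc k
      g = generators a h (suc k) d
      H = + (a ℕ.* h)
      H≡ : H ≡ A ℤ.* + h
      H≡ = ℤ.pos-* a h
      V = proj₁ (slope-positive a h k d a<ah+kd minimal)
      slope : + q ℤ.* + h ℤ.+ d ≡ + suc V
      slope = proj₂ (slope-positive a h k d a<ah+kd minimal)

    open Congruence a

    c : ℕ → ℕ
    c s = ⌈ s /1+ k ⌉

    f : ℕ → ℤ
    f s = + c s ℤ.* H ℤ.+ + s ℤ.* d

    -- Dividing s - 1 instead of s by `suc k` puts the leftover index between 1 and `suc k`. So `t`
    -- copies of the last generator and one further generator suffice, and their number `t + 1` is
    -- exactly the ceiling.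
    f∈⟨⟩ : ∀ {s} → 1 ≤ s → f s ∈ ⟨ g ⟩
    f∈⟨⟩ {suc s} _ = subst (_∈ ⟨ g ⟩) eq
      (⟨⟩-+ g (⟨⟩-* g t (generator∈⟨⟩ g (suc (Fin.fromℕ k)))) (generator∈⟨⟩ g (suc (fromℕ< (m%n<n s (suc k))))))
      where
      open ≡-Reasoning
      t = s / suc k
      r = s % suc k
      eq : + t ℤ.* (H ℤ.+ + suc (toℕ (Fin.fromℕ k)) ℤ.* d) ℤ.+ (H ℤ.+ + suc (toℕ (fromℕ< (m%n<n s (suc k)))) ℤ.* d)
           ≡ f (suc s)
      eq = begin
        + t ℤ.* (H ℤ.+ + suc (toℕ (Fin.fromℕ k)) ℤ.* d) ℤ.+ (H ℤ.+ + suc (toℕ (fromℕ< (m%n<n s (suc k)))) ℤ.* d)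
          ≡⟨ cong₂ (λ x y → + t ℤ.* (H ℤ.+ + suc x ℤ.* d) ℤ.+ (H ℤ.+ + suc y ℤ.* d)) (toℕ-fromℕ k) (toℕ-fromℕ< (m%n<n s (suc k))) ⟩
        + t ℤ.* (H ℤ.+ + suc k ℤ.* d) ℤ.+ (H ℤ.+ (+ 1 ℤ.+ + r) ℤ.* d)
          ≡⟨ solve 5 (λ t H k d r → t :* (H :+ k :* d) :+ (H :+ (con (+ 1) :+ r) :* d) :=
                 (con (+ 1) :+ t) :* H :+ (con (+ 1) :+ (r :+ t :* k)) :* d) refl (+ t) H (+ suc k) d (+ r) ⟩
        + suc t ℤ.* H ℤ.+ (+ 1 ℤ.+ (+ r ℤ.+ + t ℤ.* + suc k)) ℤ.* d
          ≡⟨ cong₂ (λ x y → + x ℤ.* H ℤ.+ (+ 1 ℤ.+ y) ℤ.* d) (sym (⌈/⌉-suc {k} s))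
               (trans (cong (λ x → + r ℤ.+ x) (sym (ℤ.pos-* t (suc k)))) (cong +_ (sym (m≡m%n+[m/n]*n s (suc k))))) ⟩
        f (suc s) ∎

    -- With K for `suc k`, K f(s) = (c(s)K - s)ah + s(ah + Kd), and both summands are nonnegative
    -- even if d is negative. This is what lets f(s) + Ua count as an element of `S`, which lives in
    -- ℕ.
    f-nonNeg : ∀ s → ∃[ y ] f s ≡ + y
    f-nonNeg s = *-nonNeg-cancel k eq
      where
      open ≡-Reasoning
      e = c s ℕ.* suc k ∸ s
      U = 0<⇒+suc (ℤ.≤-<-trans (ℤ.+≤+ z≤n) a<ah+kd)
      eq : + suc k ℤ.* f s ≡ + (e ℕ.* (a ℕ.* h) ℕ.+ s ℕ.* suc (proj₁ U))
      eq = begin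
        + suc k ℤ.* (+ c s ℤ.* H ℤ.+ + s ℤ.* d)
          ≡⟨ solve 5 (λ k c H s d → k :* (c :* H :+ s :* d) := c :* k :* H :+ s :* (k :* d)) refl (+ suc k) (+ c s) H (+ s) d ⟩
        + c s ℤ.* + suc k ℤ.* H ℤ.+ + s ℤ.* (+ suc k ℤ.* d)
          ≡⟨ cong (λ x → x ℤ.* H ℤ.+ + s ℤ.* (+ suc k ℤ.* d))
               (trans (sym (ℤ.pos-* (c s) (suc k))) (cong +_ (sym (ℕ.m∸n+n≡m (⌈/⌉-upper {k} s))))) ⟩
        (+ e ℤ.+ + s) ℤ.* H ℤ.+ + s ℤ.* (+ suc k ℤ.* d)
          ≡⟨ solve 4 (λ e s H x → (e :+ s) :* H :+ s :* x := e :* H :+ s :* (H :+ x)) refl (+ e) (+ s) H (+ suc k ℤ.* d) ⟩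
        + e ℤ.* H ℤ.+ + s ℤ.* (H ℤ.+ + suc k ℤ.* d)
          ≡⟨ cong (λ x → + e ℤ.* H ℤ.+ + s ℤ.* x) (proj₂ U) ⟩
        + e ℤ.* H ℤ.+ + s ℤ.* + suc (proj₁ U)
          ≡⟨ cong₂ (λ x y → x ℤ.+ y) (sym (ℤ.pos-* e (a ℕ.* h))) (sym (ℤ.pos-* s (suc (proj₁ U)))) ⟩
        + (e ℕ.* (a ℕ.* h) ℕ.+ s ℕ.* suc (proj₁ U)) ∎

    -- `N` counts the generators used, with multiplicity, and `M` adds up their indices. The bound
    -- says that `N` is at least the ceiling of `M`, which is all that is remembered of the
    -- combination.
    decompose : ∀ {n} (b r : Vector ℕ n) → (∀ j → r j ≤ suc k) →
      ∃[ N ] ∃[ M ] (M ≤ N ℕ.* suc k × sum (λ j → + b j ℤ.* (H ℤ.+ + r j ℤ.* d)) ≡ + N ℤ.* H ℤ.+ + M ℤ.* d)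
    decompose {zero}  b r r≤ = 0 , 0 , z≤n , refl
    decompose {suc n} b r r≤ with decompose (λ j → b (suc j)) (λ j → r (suc j)) (λ j → r≤ (suc j))
    ... | N , M , M≤ , eq = b₀ ℕ.+ N , b₀ ℕ.* r₀ ℕ.+ M ,
      subst (b₀ ℕ.* r₀ ℕ.+ M ≤_) (sym (ℕ.*-distribʳ-+ (suc k) b₀ N)) (ℕ.+-mono-≤ (ℕ.*-monoʳ-≤ b₀ (r≤ zero)) M≤) ,
      (begin
        + b₀ ℤ.* (H ℤ.+ + r₀ ℤ.* d) ℤ.+ _
          ≡⟨ cong (λ x → + b₀ ℤ.* (H ℤ.+ + r₀ ℤ.* d) ℤ.+ x) eq ⟩
        + b₀ ℤ.* (H ℤ.+ + r₀ ℤ.* d) ℤ.+ (+ N ℤ.* H ℤ.+ + M ℤ.* d)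
          ≡⟨ solve 6 (λ b H r d N M → b :* (H :+ r :* d) :+ (N :* H :+ M :* d) := (b :+ N) :* H :+ (b :* r :+ M) :* d)
               refl (+ b₀) H (+ r₀) d (+ N) (+ M) ⟩
        (+ b₀ ℤ.+ + N) ℤ.* H ℤ.+ (+ b₀ ℤ.* + r₀ ℤ.+ + M) ℤ.* d
          ≡⟨ cong (λ x → (+ b₀ ℤ.+ + N) ℤ.* H ℤ.+ (x ℤ.+ + M) ℤ.* d) (ℤ.pos-* b₀ r₀) ⟨
        + (b₀ ℕ.+ N) ℤ.* H ℤ.+ + (b₀ ℕ.* r₀ ℕ.+ M) ℤ.* d ∎)
      where
      open ≡-Reasoning
      b₀ = b zero
      r₀ = r zero

    private
      Bézout-d = bézout a d gcd≡1
      β = proj₁ (proj₂ Bézout-d)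
      βd≡ = proj₂ (proj₂ Bézout-d)

      cancel-d : ∀ x y → x ℤ.* d ≈ₐ y ℤ.* d → x ≈ₐ y
      cancel-d x y = ≈ₐ-*-cancelʳ {d} {proj₁ Bézout-d} {β} βd≡ {x} {y}

    decompose-⟨⟩ : ∀ {z} → z ∈ ⟨ g ⟩ →
      ∃[ b ] ∃[ N ] ∃[ M ] (M ≤ N ℕ.* suc k × z ≡ + b ℤ.* A ℤ.+ (+ N ℤ.* H ℤ.+ + M ℤ.* d))
    decompose-⟨⟩ (b , z≡) with decompose (λ j → b (suc j)) residue toℕ<n
    ... | N , M , M≤ , eq = b zero , N , M , M≤ , trans z≡ (cong (λ x → + b zero ℤ.* A ℤ.+ x) eq)

    -- ⌈(s + ta)/k⌉ ≥ ⌈s/k⌉ + tq for q = ⌊a/k⌋, so passing from s to s + ta raises f by at least ta(qh + d) > 0.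
    ⟨⟩-above-f : ∀ {w s} → + w ∈ ⟨ g ⟩ → + w ≈ₐ + s ℤ.* d → s < a → ∃[ U ] + w ≡ f s ℤ.+ + U ℤ.* A
    ⟨⟩-above-f {w} {s} w∈⟨⟩ w≈sd s<a with decompose-⟨⟩ w∈⟨⟩
    ... | b , N , M , M≤ , w≡ = above (≈ₐ⇒≡+* (cancel-d (+ M) (+ s) (≈ₐ-trans (≈ₐ-sym w≈Md) w≈sd)) s<a)
      where
      open ≡-Reasoning
      w≈Md : + w ≈ₐ + M ℤ.* d
      w≈Md = shift (+ b ℤ.+ + N ℤ.* + h) (begin
        + w                                               ≡⟨ w≡ ⟩
        + b ℤ.* A ℤ.+ (+ N ℤ.* H ℤ.+ + M ℤ.* d)      ≡⟨ cong (λ x → + b ℤ.* A ℤ.+ (+ N ℤ.* x ℤ.+ + M ℤ.* d)) H≡ ⟩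
        + b ℤ.* A ℤ.+ (+ N ℤ.* (A ℤ.* + h) ℤ.+ + M ℤ.* d)
          ≡⟨ solve 5 (λ b a N h x → b :* a :+ (N :* (a :* h) :+ x) := x :+ (b :+ N :* h) :* a) refl (+ b) A (+ N) (+ h) (+ M ℤ.* d) ⟩
        + M ℤ.* d ℤ.+ (+ b ℤ.+ + N ℤ.* + h) ℤ.* A    ∎)
      above : ∃[ t ] M ≡ s ℕ.+ t ℕ.* a → ∃[ U ] + w ≡ f s ℤ.+ + U ℤ.* A
      -- The three summands of the excess: copies of `a`, the `e` generators beyond c(s) + tq, each
      -- worth h multiples of `a`, and the `t` wraps, each worth the slope.
      above (t , refl) = b ℕ.+ e ℕ.* h ℕ.+ t ℕ.* suc V , (begin
        + w                                               ≡⟨ w≡ ⟩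
        + b ℤ.* A ℤ.+ (+ N ℤ.* H ℤ.+ + (s ℕ.+ t ℕ.* a) ℤ.* d)
          ≡⟨ cong₂ (λ x y → + b ℤ.* A ℤ.+ (x ℤ.* H ℤ.+ (+ s ℤ.+ y) ℤ.* d))
               (trans (cong +_ (sym (ℕ.m∸n+n≡m cs+tq≤N))) (cong (λ x → + e ℤ.+ (+ c s ℤ.+ x)) (ℤ.pos-* t q))) (ℤ.pos-* t a) ⟩
        + b ℤ.* A ℤ.+ ((+ e ℤ.+ (+ c s ℤ.+ + t ℤ.* + q)) ℤ.* H ℤ.+ (+ s ℤ.+ + t ℤ.* A) ℤ.* d)
          ≡⟨ shift-identity A (+ h) (+ q) d H (+ suc V) H≡ slope (+ b) (+ e) (+ c s) (+ t) (+ s) ⟩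
        f s ℤ.+ (+ b ℤ.+ + e ℤ.* + h ℤ.+ + t ℤ.* + suc V) ℤ.* A
          ≡⟨ cong₂ (λ x y → f s ℤ.+ (+ b ℤ.+ x ℤ.+ y) ℤ.* A) (sym (ℤ.pos-* e h)) (sym (ℤ.pos-* t (suc V))) ⟩
        f s ℤ.+ + (b ℕ.+ e ℕ.* h ℕ.+ t ℕ.* suc V) ℤ.* A ∎)
        where
        cs+tq≤N : c s ℕ.+ t ℕ.* q ≤ N
        cs+tq≤N = ℕ.≤-trans (⌈/⌉-+* {k} s t a) (⌈/⌉-least M≤)
        e = N ∸ (c s ℕ.+ t ℕ.* q)

    -- If the excess over f(s) were `suc U` multiples of `a`, then w - a = f(s) + Ua would still lie
    -- in `S`.
    apéry≡f : ∀ {w s} → w ∈ Apéry S a → + w ≈ₐ + s ℤ.* d → 1 ≤ s → s < a → + w ≡ f s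
    apéry≡f {w} {s} (w∈S , w-a∉S) w≈sd 1≤s s<a = least (⟨⟩-above-f {w} {s} (proj₁ generated {w} w∈S) w≈sd s<a)
      where
      open ≡-Reasoning
      least : ∃[ U ] + w ≡ f s ℤ.+ + U ℤ.* A → + w ≡ f s
      least (zero , w≡) = trans w≡ (trans (cong (λ x → f s ℤ.+ x) (ℤ.*-zeroˡ A)) (ℤ.+-identityʳ (f s)))
      least (suc U , w≡) = ⊥-elim (w-a∉S (y ℕ.+ U ℕ.* a , r+a≡w , proj₂ generated r∈⟨⟩))
        where
        y = proj₁ (f-nonNeg s)
        r≡ : f s ℤ.+ + U ℤ.* A ≡ + (y ℕ.+ U ℕ.* a)
        r≡ = cong₂ (λ u v → u ℤ.+ v) (proj₂ (f-nonNeg s)) (sym (ℤ.pos-* U a))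
        r∈⟨⟩ : + (y ℕ.+ U ℕ.* a) ∈ ⟨ g ⟩
        r∈⟨⟩ = subst (_∈ ⟨ g ⟩) r≡ (⟨⟩-+ g {f s} {+ U ℤ.* A} (f∈⟨⟩ 1≤s) (⟨⟩-* g U {A} (generator∈⟨⟩ g zero)))
        r+a≡w : y ℕ.+ U ℕ.* a ℕ.+ a ≡ w
        r+a≡w = ℤ.+-injective (begin
          + (y ℕ.+ U ℕ.* a) ℤ.+ A               ≡⟨ cong (ℤ._+ A) r≡ ⟨
          f s ℤ.+ + U ℤ.* A ℤ.+ A               ≡⟨ ℤ.+-assoc (f s) (+ U ℤ.* A) A ⟩
          f s ℤ.+ (+ U ℤ.* A ℤ.+ A)             ≡⟨ cong (λ x → f s ℤ.+ x) (ℤ.+-comm (+ U ℤ.* A) A) ⟩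
          f s ℤ.+ (A ℤ.+ + U ℤ.* A)             ≡⟨ cong (λ x → f s ℤ.+ x) (ℤ.suc-* (+ U) A) ⟨
          f s ℤ.+ + suc U ℤ.* A                 ≡⟨ w≡ ⟨
          + w                                   ∎)

    -- σ and index are division and multiplication by d on the nonzero residues modulo a.
    σ : Fin (a ∸ 1) → ℕ
    σ i = (+ residue i ℤ.* β) %ℕ a

    σ<a : ∀ i → σ i < a
    σ<a i = n%ℕd<d (+ residue i ℤ.* β) a

    σd≈residue : ∀ i → + σ i ℤ.* d ≈ₐ + residue i
    σd≈residue i = ≈ₐ-trans (≈ₐ-*ʳ d (≈ₐ-sym (≈ₐ-%ℕ (+ residue i ℤ.* β)))) (shift (ℤ.- (+ residue i ℤ.* α)) (begin
      + residue i ℤ.* β ℤ.* d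
        ≡⟨ solve 5 (λ r β d α a → r :* β :* d := r :* (α :* a :+ β :* d) :+ (:- (r :* α)) :* a) refl (+ residue i) β d α A ⟩
      + residue i ℤ.* (α ℤ.* A ℤ.+ β ℤ.* d) ℤ.+ ℤ.- (+ residue i ℤ.* α) ℤ.* A
        ≡⟨ cong (λ x → x ℤ.+ ℤ.- (+ residue i ℤ.* α) ℤ.* A) (trans (cong (+ residue i ℤ.*_) βd≡) (ℤ.*-identityʳ (+ residue i))) ⟩
      + residue i ℤ.+ ℤ.- (+ residue i ℤ.* α) ℤ.* A ∎))
      where
      open ≡-Reasoning
      α = proj₁ Bézout-d

    residue<a : ∀ (i : Fin (a ∸ 1)) → residue i < a
    residue<a i = ℕ.≤-trans (s≤s (toℕ<n i)) (ℕ.≤-reflexive (ℕ.m+[n∸m]≡n 1≤a))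

    1≤σ : ∀ i → 1 ≤ σ i
    1≤σ i = positive (σ i) (σd≈residue i)
      where
      positive : ∀ s → + s ℤ.* d ≈ₐ + residue i → 1 ≤ s
      positive (suc s) _ = s≤s z≤n
      positive zero   0≈ = ⊥-elim (ℕ.0≢1+n (≈ₐ⇒≡ {0} {residue i}
        (subst (_≈ₐ + residue i) (ℤ.*-zeroˡ d) 0≈) 1≤a (residue<a i)))

    index : ℕ → Fin (a ∸ 1)
    index s = fromℕ< {ℕ.pred ((+ s ℤ.* d) %ℕ a)} (pred< (n%ℕd<d (+ s ℤ.* d) a))
      where
      pred< : ∀ {x} → x < a → ℕ.pred x < a ∸ 1
      -- `pred` is there because the position i stands for the residue i + 1. The reduced product is
      -- 0 only when `a` divides `s`; `index` then takes an arbitrary value, available because `a`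
      -- is at least 2.
      pred< {zero}  _   = ℕ.m<n⇒0<n∸m (ℕ.≤-<-trans 1≤k k<a)
      pred< {suc x} x<a = ℕ.∸-monoˡ-≤ 1 x<a

    residue-index : ∀ {s} → 1 ≤ s → s < a → + residue (index s) ≈ₐ + s ℤ.* d
    residue-index {s} 1≤s s<a = ≈ₐ-sym (subst (λ x → + s ℤ.* d ≈ₐ + x) eq (≈ₐ-%ℕ (+ s ℤ.* d)))
      where
      eq : (+ s ℤ.* d) %ℕ a ≡ residue (index s)
      eq = trans (pos ((+ s ℤ.* d) %ℕ a) (≈ₐ-%ℕ (+ s ℤ.* d))) (cong suc (sym (toℕ-fromℕ< _)))
        where
        pos : ∀ x → + s ℤ.* d ≈ₐ + x → x ≡ suc (ℕ.pred x)
        pos (suc x) _ = refl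
        pos zero sd≈0 = ⊥-elim (ℕ.<⇒≢ 1≤s (sym (≈ₐ⇒≡ {s} {0}
          (cancel-d (+ s) (+ 0) (subst (+ s ℤ.* d ≈ₐ_) (sym (ℤ.*-zeroˡ d)) sd≈0)) s<a 1≤a)))

    σ-index : ∀ {s} → 1 ≤ s → s < a → σ (index s) ≡ s
    σ-index {s} 1≤s s<a = ≈ₐ⇒≡ (cancel-d (+ σ (index s)) (+ s) (≈ₐ-trans (σd≈residue (index s)) (residue-index 1≤s s<a))) (σ<a (index s)) s<a

    index-σ : ∀ i → index (σ i) ≡ i
    index-σ i = toℕ-injective (ℕ.suc-injective
      (≈ₐ⇒≡ (≈ₐ-trans (residue-index (1≤σ i) (σ<a i)) (σd≈residue i)) (residue<a (index (σ i))) (residue<a i)))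

    module _ {w : Vector ℕ (a ∸ 1)} (isTuple : IsApéryTuple S a w) where

      w≈residue : ∀ i → + w i ≈ₐ + residue i
      w≈residue i = shift (+ (w i / a)) (trans (cong +_ (m≡m%n+[m/n]*n (w i) a))
        (cong₂ (λ x y → + x ℤ.+ y) (proj₂ (isTuple i)) (ℤ.pos-* (w i / a) a)))

      w≡f∘σ : ∀ i → + w i ≡ f (σ i)
      w≡f∘σ i = apéry≡f (proj₁ (isTuple i)) (≈ₐ-trans (w≈residue i) (≈ₐ-sym (σd≈residue i))) (1≤σ i) (σ<a i)

      -- The difference w(i) + w(j) - w(l) is a(eh + t(qh + d)), where `t` counts the wraps modulo
      -- `a` and `e` the surplus of the ceilings. Tightness makes it zero; as h and the slope are
      -- positive, both `e` and `t` vanish.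
      tight⇒additive : ∀ i j l → (residue i ℕ.+ residue j) % a ≡ residue l → w l ≡ w i ℕ.+ w j →
                       σ i ℕ.+ σ j ≡ σ l × c (σ i) ℕ.+ c (σ j) ≡ c (σ l)
      tight⇒additive i j l r≡ w≡ =
        let t , σ+σ≡ = ≈ₐ⇒≡+* (cancel-d (+ (σ i ℕ.+ σ j)) (+ σ l) σ+σ≈) (σ<a l) in additive t σ+σ≡
        where
        open ≡-Reasoning
        r≈ : + residue i ℤ.+ + residue j ≈ₐ + residue l
        r≈ = shift (+ ((residue i ℕ.+ residue j) / a)) (trans (cong +_ (m≡m%n+[m/n]*n (residue i ℕ.+ residue j) a))
          (cong₂ (λ x y → + x ℤ.+ y) r≡ (ℤ.pos-* ((residue i ℕ.+ residue j) / a) a)))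
        σ+σ≈ : + (σ i ℕ.+ σ j) ℤ.* d ≈ₐ + σ l ℤ.* d
        σ+σ≈ = ≈ₐ-trans (subst (_≈ₐ + residue i ℤ.+ + residue j) (sym (ℤ.*-distribʳ-+ d (+ σ i) (+ σ j)))
                           (≈ₐ-+ (σd≈residue i) (σd≈residue j)))
                 (≈ₐ-trans r≈ (≈ₐ-sym (σd≈residue l)))
        additive : ∀ t → σ i ℕ.+ σ j ≡ σ l ℕ.+ t ℕ.* a → σ i ℕ.+ σ j ≡ σ l × c (σ i) ℕ.+ c (σ j) ≡ c (σ l)
        additive t σ+σ≡ = trans σ+σ≡ (trans (cong (λ x → σ l ℕ.+ x ℕ.* a) t≡0) (ℕ.+-identityʳ _)) ,
                       trans (sym ce≡) (trans (cong₂ (λ x y → x ℕ.+ (c (σ l) ℕ.+ y ℕ.* q)) e≡0 t≡0) (ℕ.+-identityʳ _))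
         where
          -- The truncated difference is exact, because c(σl) + tq ≤ c(σl + ta) = c(σi + σj) ≤ c(σi)
          -- + c(σj).
          e = c (σ i) ℕ.+ c (σ j) ∸ (c (σ l) ℕ.+ t ℕ.* q)
          ce≡ : e ℕ.+ (c (σ l) ℕ.+ t ℕ.* q) ≡ c (σ i) ℕ.+ c (σ j)
          ce≡ = ℕ.m∸n+n≡m (ℕ.≤-trans (⌈/⌉-+* {k} (σ l) t a)
                  (ℕ.≤-trans (ℕ.≤-reflexive (cong c (sym σ+σ≡))) (⌈/⌉-subadditive {k} (σ i) (σ j))))
          f+f≡ : f (σ i) ℤ.+ f (σ j) ≡ f (σ l) ℤ.+ A ℤ.* + (e ℕ.* h ℕ.+ t ℕ.* suc V)
          f+f≡ = begin
            f (σ i) ℤ.+ f (σ j)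
              ≡⟨ solve 6 (λ x y H s t d → x :* H :+ s :* d :+ (y :* H :+ t :* d) := (x :+ y) :* H :+ (s :+ t) :* d)
                   refl (+ c (σ i)) (+ c (σ j)) H (+ σ i) (+ σ j) d ⟩
            + (c (σ i) ℕ.+ c (σ j)) ℤ.* H ℤ.+ + (σ i ℕ.+ σ j) ℤ.* d
              ≡⟨ cong₂ (λ x y → x ℤ.* H ℤ.+ y ℤ.* d)
                   (trans (cong +_ (sym ce≡)) (cong (λ x → + e ℤ.+ (+ c (σ l) ℤ.+ x)) (ℤ.pos-* t q)))
                   (trans (cong +_ σ+σ≡) (cong (λ x → + σ l ℤ.+ x) (ℤ.pos-* t a))) ⟩
            (+ e ℤ.+ (+ c (σ l) ℤ.+ + t ℤ.* + q)) ℤ.* H ℤ.+ (+ σ l ℤ.+ + t ℤ.* A) ℤ.* d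
              ≡⟨ ℤ.+-identityˡ _ ⟨
            + 0 ℤ.* A ℤ.+ ((+ e ℤ.+ (+ c (σ l) ℤ.+ + t ℤ.* + q)) ℤ.* H ℤ.+ (+ σ l ℤ.+ + t ℤ.* A) ℤ.* d)
              ≡⟨ shift-identity A (+ h) (+ q) d H (+ suc V) H≡ slope (+ 0) (+ e) (+ c (σ l)) (+ t) (+ σ l) ⟩
            f (σ l) ℤ.+ (+ 0 ℤ.+ + e ℤ.* + h ℤ.+ + t ℤ.* + suc V) ℤ.* A
              ≡⟨ cong (λ x → f (σ l) ℤ.+ x) (trans (cong (λ x → (x ℤ.+ + t ℤ.* + suc V) ℤ.* A) (ℤ.+-identityˡ (+ e ℤ.* + h))) (ℤ.*-comm _ A)) ⟩
            f (σ l) ℤ.+ A ℤ.* (+ e ℤ.* + h ℤ.+ + t ℤ.* + suc V)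
              ≡⟨ cong₂ (λ x y → f (σ l) ℤ.+ A ℤ.* (x ℤ.+ y)) (sym (ℤ.pos-* e h)) (sym (ℤ.pos-* t (suc V))) ⟩
            f (σ l) ℤ.+ A ℤ.* + (e ℕ.* h ℕ.+ t ℕ.* suc V) ∎
          excess≡0 : e ℕ.* h ℕ.+ t ℕ.* suc V ≡ 0
          excess≡0 = ℤ.+-injective (ℤ.*-cancelˡ-≡ A _ (+ 0) (begin
            A ℤ.* E                                  ≡⟨ solve 2 (λ x y → y := x :+ y :- x) refl (f (σ l)) (A ℤ.* E) ⟩
            f (σ l) ℤ.+ A ℤ.* E ℤ.- f (σ l)          ≡⟨ cong (ℤ._- f (σ l)) f+f≡ ⟨
            f (σ i) ℤ.+ f (σ j) ℤ.- f (σ l)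
              ≡⟨ cong₂ (λ x y → x ℤ.- y) (cong₂ (λ x y → x ℤ.+ y) (w≡f∘σ i) (w≡f∘σ j)) (w≡f∘σ l) ⟨
            + (w i ℕ.+ w j) ℤ.- + w l                ≡⟨ cong (λ x → + x ℤ.- + w l) w≡ ⟨
            + w l ℤ.- + w l                          ≡⟨ ℤ.+-inverseʳ (+ w l) ⟩
            + 0                                      ≡⟨ ℤ.*-zeroʳ A ⟨
            A ℤ.* + 0                                ∎))
            where E = + (e ℕ.* h ℕ.+ t ℕ.* suc V)
          e≡0 : e ≡ 0
          e≡0 = ℕ.m*n≡0⇒m≡0 e h {{ℕ.>-nonZero 1≤h}} (ℕ.m+n≡0⇒m≡0 (e ℕ.* h) excess≡0)
          t≡0 : t ≡ 0
          t≡0 = ℕ.m*n≡0⇒m≡0 t (suc V) (ℕ.m+n≡0⇒n≡0 (e ℕ.* h) excess≡0)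

      additive⇒tight : ∀ {s t} → 1 ≤ s → 1 ≤ t → s ℕ.+ t < a → c s ℕ.+ c t ≡ c (s ℕ.+ t) →
        (residue (index s) ℕ.+ residue (index t)) % a ≡ residue (index (s ℕ.+ t)) ×
        w (index (s ℕ.+ t)) ≡ w (index s) ℕ.+ w (index t)
      additive⇒tight {s} {t} 1≤s 1≤t s+t<a c≡ = r%≡ , ℤ.+-injective (begin
        + w (index (s ℕ.+ t))             ≡⟨ w-index {s ℕ.+ t} 1≤s+t s+t<a ⟩
        + c (s ℕ.+ t) ℤ.* H ℤ.+ + (s ℕ.+ t) ℤ.* d
                                          ≡⟨ cong (λ x → + x ℤ.* H ℤ.+ + (s ℕ.+ t) ℤ.* d) c≡ ⟨
        + (c s ℕ.+ c t) ℤ.* H ℤ.+ + (s ℕ.+ t) ℤ.* d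
          ≡⟨ solve 6 (λ x y H s t d → (x :+ y) :* H :+ (s :+ t) :* d := x :* H :+ s :* d :+ (y :* H :+ t :* d))
                 refl (+ c s) (+ c t) H (+ s) (+ t) d ⟩
        f s ℤ.+ f t                       ≡⟨ cong₂ (λ x y → x ℤ.+ y) (w-index {s} 1≤s s<a) (w-index {t} 1≤t t<a) ⟨
        + (w (index s) ℕ.+ w (index t))   ∎)
        where
        open ≡-Reasoning
        s<a = ℕ.≤-<-trans (ℕ.m≤m+n s t) s+t<a
        t<a = ℕ.≤-<-trans (ℕ.m≤n+m t s) s+t<a
        1≤s+t = ℕ.≤-trans 1≤s (ℕ.m≤m+n s t)
        w-index : ∀ {s} → 1 ≤ s → s < a → + w (index s) ≡ f s
        w-index {s} 1≤s s<a = trans (w≡f∘σ (index s)) (cong f (σ-index {s} 1≤s s<a))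
        r≈ : + residue (index s) ℤ.+ + residue (index t) ≈ₐ + residue (index (s ℕ.+ t))
        r≈ = ≈ₐ-trans (≈ₐ-+ (residue-index {s} 1≤s s<a) (residue-index {t} 1≤t t<a))
               (subst (_≈ₐ + residue (index (s ℕ.+ t))) (ℤ.*-distribʳ-+ d (+ s) (+ t)) (≈ₐ-sym (residue-index {s ℕ.+ t} 1≤s+t s+t<a)))
        r%≡ : (residue (index s) ℕ.+ residue (index t)) % a ≡ residue (index (s ℕ.+ t))
        r%≡ = reduce (residue<a (index (s ℕ.+ t))) (≈ₐ⇒≡+* r≈ (residue<a (index (s ℕ.+ t))))
          where
          reduce : ∀ {x r} → r < a → ∃[ u ] x ≡ r ℕ.+ u ℕ.* a → x % a ≡ r
          reduce {r = r} r<a (u , refl) = trans ([m+kn]%n≡m%n r u a) (m<n⇒m%n≡m r<a)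

open NumericalSemigroups

-- Ordered fields

module FieldProperties {c ℓ₁ ℓ₂} (K : OrderedField c ℓ₁ ℓ₂) where
  open OrderedField K public
  open CommutativeRing commutativeRing public
    using ( refl; reflexive; sym; trans; setoid; ring; +-cong; +-congˡ; +-congʳ; *-congˡ; *-congʳ
          ; -‿cong; -‿inverseʳ; +-identityˡ; +-identityʳ; +-comm; +-assoc
          ; zeroˡ; zeroʳ; *-identityˡ; *-identityʳ; *-comm; distribˡ)
  open Algebra.Properties.Semiring.Sum semiring public
    using (sum-cong-≋; *-distribˡ-sum; ∑-distrib-+; sum-replicate-zero)
  open Algebra.Properties.Semiring.Mult semiring public
    using (×-homo-+; ×1-homo-*)
  open Algebra.Properties.Ring ring
    using (-0#≈0#; -‿+-comm; -‿involutive; -‿distribˡ-*; -‿distribʳ-*)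
  module S = IsStrictTotalOrder isStrictTotalOrder
  open S public using (compare; irrefl) renaming (trans to <-trans; <-respˡ-≈ to <-respˡ; <-respʳ-≈ to <-respʳ)
  open import Relation.Binary.Reasoning.Setoid setoid

  -- The ring solver needs coefficients with decidable equality in order to cancel terms.
  ℤ⟦_⟧ : ℤ → Carrier
  ℤ⟦ + n ⟧      = n ×# 1#
  ℤ⟦ -[1+ n ] ⟧ = - (suc n ×# 1#)

  private
    ⊖-homo : ∀ m n → ℤ⟦ m ℤ.⊖ n ⟧ ≈ m ×# 1# + - (n ×# 1#)
    ⊖-homo m       zero    = sym (trans (+-congˡ -0#≈0#) (+-identityʳ _))
    ⊖-homo zero    (suc n) = sym (+-identityˡ _)
    ⊖-homo (suc m) (suc n) = begin
      ℤ⟦ suc m ℤ.⊖ suc n ⟧                    ≡⟨ ≡.cong ℤ⟦_⟧ (ℤ.[1+m]⊖[1+n]≡m⊖n m n) ⟩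
      ℤ⟦ m ℤ.⊖ n ⟧                            ≈⟨ ⊖-homo m n ⟩
      M + - N                                 ≈⟨ +-congʳ (+-identityˡ M) ⟨
      0# + M + - N                            ≈⟨ +-congʳ (+-congʳ (-‿inverseʳ 1#)) ⟨
      1# + - 1# + M + - N                     ≈⟨ +-congʳ (+-assoc _ _ _) ⟩
      1# + (- 1# + M) + - N                   ≈⟨ +-congʳ (+-congˡ (+-comm _ _)) ⟩
      1# + (M + - 1#) + - N                   ≈⟨ +-congʳ (+-assoc _ _ _) ⟨
      1# + M + - 1# + - N                     ≈⟨ +-assoc _ _ _ ⟩
      1# + M + (- 1# + - N)                   ≈⟨ +-congˡ (-‿+-comm 1# N) ⟩
      1# + M + - (1# + N)                     ∎
      where M = m ×# 1# ; N = n ×# 1#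

    +-homo : ∀ i j → ℤ⟦ i ℤ.+ j ⟧ ≈ ℤ⟦ i ⟧ + ℤ⟦ j ⟧
    +-homo (+ m)      (+ n)      = ×-homo-+ 1# m n
    +-homo (+ m)      -[1+ n ]   = ⊖-homo m (suc n)
    +-homo -[1+ m ]   (+ n)      = trans (⊖-homo n (suc m)) (+-comm _ _)
    +-homo -[1+ m ]   -[1+ n ]   = begin
      - (suc (suc (m ℕ.+ n)) ×# 1#)          ≡⟨ ≡.cong (λ l → - (suc l ×# 1#)) (≡.sym (ℕ.+-suc m n)) ⟩
      - ((suc m ℕ.+ suc n) ×# 1#)            ≈⟨ -‿cong (×-homo-+ 1# (suc m) (suc n)) ⟩
      - (suc m ×# 1# + suc n ×# 1#)          ≈⟨ -‿+-comm _ _ ⟨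
      - (suc m ×# 1#) + - (suc n ×# 1#)      ∎

    -‿homo : ∀ i → ℤ⟦ ℤ.- i ⟧ ≈ - ℤ⟦ i ⟧
    -‿homo (+ zero)   = sym -0#≈0#
    -‿homo (+ suc n)  = refl
    -‿homo -[1+ n ]   = sym (-‿involutive _)

    -◃-homo : ∀ n → ℤ⟦ Sign.- ℤ.◃ n ⟧ ≈ - (n ×# 1#)
    -◃-homo n = trans (reflexive (≡.cong ℤ⟦_⟧ (ℤ.-◃n≡-n n))) (-‿homo (+ n))

    *-homo : ∀ i j → ℤ⟦ i ℤ.* j ⟧ ≈ ℤ⟦ i ⟧ * ℤ⟦ j ⟧
    *-homo (+ m) (+ n) = begin
      ℤ⟦ Sign.+ ℤ.◃ (m ℕ.* n) ⟧  ≡⟨ ≡.cong ℤ⟦_⟧ (ℤ.+◃n≡+n (m ℕ.* n)) ⟩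
      (m ℕ.* n) ×# 1#            ≈⟨ ×1-homo-* m n ⟩
      (m ×# 1#) * (n ×# 1#)      ∎
    *-homo (+ m) -[1+ n ] = begin
      ℤ⟦ Sign.- ℤ.◃ (m ℕ.* suc n) ⟧ ≈⟨ -◃-homo (m ℕ.* suc n) ⟩
      - ((m ℕ.* suc n) ×# 1#)       ≈⟨ -‿cong (×1-homo-* m (suc n)) ⟩
      - ((m ×# 1#) * (suc n ×# 1#)) ≈⟨ -‿distribʳ-* _ _ ⟩
      (m ×# 1#) * - (suc n ×# 1#)   ∎
    *-homo -[1+ m ] (+ n) = begin
      ℤ⟦ Sign.- ℤ.◃ (suc m ℕ.* n) ⟧ ≈⟨ -◃-homo (suc m ℕ.* n) ⟩
      - ((suc m ℕ.* n) ×# 1#)       ≈⟨ -‿cong (×1-homo-* (suc m) n) ⟩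
      - ((suc m ×# 1#) * (n ×# 1#)) ≈⟨ -‿distribˡ-* _ _ ⟩
      - (suc m ×# 1#) * (n ×# 1#)   ∎
    *-homo -[1+ m ] -[1+ n ] = begin
      (suc m ℕ.* suc n) ×# 1#           ≈⟨ ×1-homo-* (suc m) (suc n) ⟩
      M * N                             ≈⟨ -‿involutive _ ⟨
      - (- (M * N))                     ≈⟨ -‿cong (-‿distribʳ-* _ _) ⟩
      - (M * - N)                       ≈⟨ -‿distribˡ-* _ _ ⟩
      - M * - N                         ∎
      where M = suc m ×# 1# ; N = suc n ×# 1#

    morphism : CommutativeRing.rawRing ℤ.+-*-commutativeRing
               -Raw-AlmostCommutative⟶ fromCommutativeRing commutativeRing
    morphism = record
      { ⟦_⟧ = ℤ⟦_⟧ ; +-homo = +-homo ; *-homo = *-homo ; -‿homo = -‿homo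
      ; 0-homo = refl ; 1-homo = +-identityʳ 1# }

    coeff≟ : ∀ i j → Maybe (ℤ⟦ i ⟧ ≈ ℤ⟦ j ⟧)
    coeff≟ i j with i ℤ.≟ j
    ... | yes ≡.refl = just refl
    ... | no  _      = nothing

  open Algebra.Solver.Ring _ (fromCommutativeRing commutativeRing) morphism coeff≟ public
    using (solve; _:=_; _:+_; _:*_; _:-_; :-_; con)

  <⇒0<- : ∀ {x y} → x < y → 0# < y - x
  <⇒0<- {x} {y} x<y = <-respˡ (-‿inverseʳ x) (+-monoˡ-< (- x) x<y)

  0<-⇒< : ∀ {x y} → 0# < y - x → x < y
  0<-⇒< {x} {y} p = <-respˡ (+-identityˡ x)
    (<-respʳ (solve 2 (λ x y → y :- x :+ x := y) refl x y) (+-monoˡ-< x p))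

  ≤⇒0≤- : ∀ {x y} → x ≤ y → 0# ≤ y - x
  ≤⇒0≤- (inj₁ x<y) = inj₁ (<⇒0<- x<y)
  ≤⇒0≤- {x} (inj₂ x≈y) = inj₂ (trans (sym (-‿inverseʳ x)) (+-congʳ x≈y))

  0≤-⇒≤ : ∀ {x y} → 0# ≤ y - x → x ≤ y
  0≤-⇒≤ (inj₁ p) = inj₁ (0<-⇒< p)
  0≤-⇒≤ {x} {y} (inj₂ p) = inj₂ (trans (sym (+-identityˡ x))
    (trans (+-congʳ p) (solve 2 (λ x y → y :- x :+ x := y) refl x y)))

  ≤-respʳ : ∀ {x y z} → y ≈ z → x ≤ y → x ≤ z
  ≤-respʳ y≈z (inj₁ p) = inj₁ (<-respʳ y≈z p)
  ≤-respʳ y≈z (inj₂ p) = inj₂ (trans p y≈z)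

  +-pos : ∀ {x y} → 0# < x → 0# < y → 0# < x + y
  +-pos {x} {y} p q = <-trans q (<-respˡ (+-identityˡ y) (+-monoˡ-< y p))

  0≤∧0≤-⇒≈0 : ∀ {x} → 0# ≤ x → 0# ≤ - x → x ≈ 0#
  0≤∧0≤-⇒≈0 (inj₂ p) _ = sym p
  0≤∧0≤-⇒≈0 {x} (inj₁ p) (inj₁ q) =
    contradiction (<-respʳ (-‿inverseʳ x) (+-pos p q)) (irrefl refl)
  0≤∧0≤-⇒≈0 {x} (inj₁ p) (inj₂ q) =
    trans (sym (-‿involutive x)) (trans (-‿cong (sym q)) -0#≈0#)

  *-monoʳ-< : ∀ {z x y} → 0# < z → x < y → z * x < z * y
  *-monoʳ-< {z} {x} {y} 0<z x<y = 0<-⇒<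
    (<-respʳ (solve 3 (λ x y z → z :* (y :- x) := z :* y :- z :* x) refl x y z)
      (*-pos 0<z (<⇒0<- x<y)))

  *-cancelˡ-0 : ∀ {x y} → 0# < x → x * y ≈ 0# → y ≈ 0#
  *-cancelˡ-0 {x} {y} 0<x xy≈0 with compare y 0#
  ... | tri≈ _ y≈0 _ = y≈0
  ... | tri> _ _ 0<y = contradiction (<-respʳ xy≈0 (*-pos 0<x 0<y)) (irrefl refl)
  ... | tri< y<0 _ _ = contradiction (<-respˡ xy≈0 (<-respʳ (zeroʳ x) (*-monoʳ-< 0<x y<0))) (irrefl refl)

  pos-inverse : ∀ {x} → 0# < x → ∃[ y ] (0# < y × x * y ≈ 1#)
  pos-inverse {x} 0<x with inverse x (λ x≈0 → irrefl (sym x≈0) 0<x)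
  ... | y , xy≈1 with compare y 0#
  ... | tri> _ _ 0<y = y , 0<y , xy≈1
  ... | tri≈ _ y≈0 _ = contradiction 0<1
        (irrefl (trans (sym (zeroʳ x)) (trans (*-congˡ (sym y≈0)) xy≈1)))
  ... | tri< y<0 _ _ = contradiction
        (<-trans 0<1 (<-respˡ xy≈1 (<-respʳ (zeroʳ x) (*-monoʳ-< 0<x y<0)))) (irrefl refl)

  0≤n×1 : ∀ n → 0# ≤ fromℕ K n
  0≤n×1 zero    = inj₂ refl
  0≤n×1 (suc n) with 0≤n×1 n
  ... | inj₁ p = inj₁ (+-pos 0<1 p)
  ... | inj₂ p = inj₁ (<-respʳ (trans (sym (+-identityʳ 1#)) (+-congˡ p)) 0<1)

  0<1+n×1 : ∀ n → 0# < fromℕ K (suc n)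
  0<1+n×1 n with 0≤n×1 n
  ... | inj₁ p = +-pos 0<1 p
  ... | inj₂ p = <-respʳ (trans (sym (+-identityʳ 1#)) (+-congˡ p)) 0<1

  -- An ordered field has characteristic zero. This brings a tight equation between coordinates in
  -- the field back to ℕ, where the arithmetic of the Apéry set applies.
  fromℕ-injective : ∀ m n → fromℕ K m ≈ fromℕ K n → m ≡ n
  fromℕ-injective zero    zero    _ = ≡.refl
  fromℕ-injective zero    (suc n) p = contradiction (0<1+n×1 n) (irrefl p)
  fromℕ-injective (suc m) zero    p = contradiction (0<1+n×1 m) (irrefl (sym p))
  fromℕ-injective (suc m) (suc n) p = ≡.cong suc (fromℕ-injective m n (begin
    M              ≈⟨ solve 2 (λ x o → x := o :+ x :- o) refl M 1# ⟩
    1# + M - 1#    ≈⟨ +-congʳ p ⟩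
    1# + N - 1#    ≈⟨ solve 2 (λ x o → o :+ x :- o := x) refl N 1# ⟩
    N              ∎))
    where M = m ×# 1# ; N = n ×# 1#

  δ : ℕ → ℕ → Carrier
  δ zero    zero    = 1#
  δ zero    (suc n) = 0#
  δ (suc m) zero    = 0#
  δ (suc m) (suc n) = δ m n

  sum≈0 : ∀ {n} (x : Vector Carrier n) → (∀ i → x i ≈ 0#) → sum x ≈ 0#
  sum≈0 {n} x x≈0 = trans (sum-cong-≋ x≈0) (sum-replicate-zero n)

  sum-*δ : ∀ {e} (f : Vector Carrier e) i → sum (λ j → f j * δ (toℕ j) (toℕ i)) ≈ f i
  sum-*δ {suc e} f zero = begin
    f zero * 1# + sum (λ j → f (suc j) * 0#)
      ≈⟨ +-cong (*-identityʳ _) (sum≈0 _ (λ j → zeroʳ (f (suc j)))) ⟩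
    f zero + 0#  ≈⟨ +-identityʳ _ ⟩
    f zero       ∎
  sum-*δ {suc e} f (suc i) = begin
    f zero * 0# + sum (λ j → f (suc j) * δ (toℕ j) (toℕ i))
      ≈⟨ +-cong (zeroʳ _) (sum-*δ (λ j → f (suc j)) i) ⟩
    0# + f (suc i)  ≈⟨ +-identityˡ _ ⟩
    f (suc i)       ∎

  -- Validity for all sufficiently small positive arguments. The notion is stable under finite
  -- conjunctions, so a single step length can be chosen for all inequalities of the cone at once.
  Eventually : ∀ {p} → Pred Carrier p → Set _
  Eventually P = ∃[ η ] (0# < η × (∀ {θ} → 0# < θ → θ ≤ η → P θ))

  ≤-trans : ∀ {x y z} → x ≤ y → y ≤ z → x ≤ z
  ≤-trans = NS.trans S.isEquivalence S.<-resp-≈ <-trans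
    where module NS = Relation.Binary.Construct.StrictToNonStrict _≈_ _<_

  eventually-× : ∀ {p q} {P : Pred Carrier p} {Q : Pred Carrier q} →
                 Eventually P → Eventually Q → Eventually (P ∩ Q)
  eventually-× (η , 0<η , p) (θ , 0<θ , q) with compare η θ
  ... | tri< η<θ _ _ = η , 0<η , λ 0<ζ ζ≤η → p 0<ζ ζ≤η , q 0<ζ (≤-trans ζ≤η (inj₁ η<θ))
  ... | tri≈ _ η≈θ _ = η , 0<η , λ 0<ζ ζ≤η → p 0<ζ ζ≤η , q 0<ζ (≤-trans ζ≤η (inj₂ η≈θ))
  ... | tri> _ _ θ<η = θ , 0<θ , λ 0<ζ ζ≤θ → p 0<ζ (≤-trans ζ≤θ (inj₁ θ<η)) , q 0<ζ ζ≤θ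

  eventually-∀ : ∀ {p n} {P : Fin n → Pred Carrier p} →
                 (∀ i → Eventually (P i)) → Eventually (λ η → ∀ i → P i η)
  eventually-∀ {n = zero}  ev = 1# , 0<1 , λ _ _ ()
  eventually-∀ {n = suc n} ev
    with eventually-× (ev zero) (eventually-∀ (λ i → ev (suc i)))
  ... | η , 0<η , p = η , 0<η , λ 0<θ θ≤η →
        λ { zero → proj₁ (p 0<θ θ≤η) ; (suc i) → proj₂ (p 0<θ θ≤η) i }

  eventually-*< : ∀ {ε} → 0# < ε → ∀ x → Eventually (λ η → η * x < ε)
  eventually-*< {ε} 0<ε x with compare x 0#
  ... | tri< x<0 _ _ = 1# , 0<1 , λ {θ} 0<θ _ →
        <-trans (<-respʳ (zeroʳ θ) (*-monoʳ-< 0<θ x<0)) 0<ε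
  ... | tri≈ _ x≈0 _ = 1# , 0<1 , λ {θ} 0<θ _ →
        <-respˡ (sym (trans (*-congˡ x≈0) (zeroʳ θ))) 0<ε
  -- The threshold is ε/(x + 1); the denominator exceeds `x` so that even at the threshold itself θx
  -- < ε is strict.
  ... | tri> _ _ 0<x with pos-inverse (+-pos 0<x 0<1)
  ... | y , 0<y , xy≈1 = ε * y , *-pos 0<ε 0<y , λ {θ} 0<θ θ≤ → bound 0<θ θ≤
    where
    x<x+1 : x < x + 1#
    x<x+1 = 0<-⇒< (<-respʳ (solve 2 (λ x o → o := x :+ o :- x) refl x 1#) 0<1)
    εy[x+1]≈ε : ε * y * (x + 1#) ≈ ε
    εy[x+1]≈ε = trans (solve 3 (λ e y z → e :* y :* z := e :* (z :* y)) refl ε y (x + 1#))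
                  (trans (*-congˡ xy≈1) (*-identityʳ ε))
    bound : ∀ {θ} → 0# < θ → θ ≤ ε * y → θ * x < ε
    bound {θ} 0<θ (inj₁ θ<) = <-trans (*-monoʳ-< 0<θ x<x+1)
      (<-respʳ εy[x+1]≈ε (<-respˡ (*-comm _ _) (<-respʳ (*-comm _ _)
        (*-monoʳ-< (+-pos 0<x 0<1) θ<))))
    bound {θ} 0<θ (inj₂ θ≈) = <-respʳ (trans (*-congʳ θ≈) εy[x+1]≈ε) (*-monoʳ-< 0<θ x<x+1)

-- The affine span of a face through a relatively interior point

module FaceSpan {c ℓ₁ ℓ₂} (K : OrderedField c ℓ₁ ℓ₂) (m : ℕ) .{{_ : NonZero m}} where
  open FieldProperties K
  open import Relation.Binary.Reasoning.Setoid setoid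

  private n = m ∸ 1

  TightSpace : Point K n → Pred (Point K n) _
  TightSpace w x = ∀ i j l → (residue i ℕ.+ residue j) % m ≡ residue l →
                   w l ≈ w i + w j → x l ≈ x i + x j

  slack : Point K n → Fin n → Fin n → Fin n → Carrier
  slack x i j l = x i + x j - x l

  slack≈0 : ∀ {x} i j l → x l ≈ x i + x j → slack x i j l ≈ 0#
  slack≈0 {x} i j l p = trans (+-congˡ (-‿cong p)) (-‿inverseʳ _)

  slack≈0⁻¹ : ∀ {x} i j l → slack x i j l ≈ 0# → x l ≈ x i + x j
  slack≈0⁻¹ {x} i j l p = begin
    x l                          ≈⟨ +-identityʳ _ ⟨
    x l + 0#                     ≈⟨ +-congˡ p ⟨
    x l + (x i + x j - x l)      ≈⟨ solve 3 (λ a b c → c :+ (a :+ b :- c) := a :+ b) refl (x i) (x j) (x l) ⟩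
    x i + x j                    ∎

  line : Point K n → Point K n → Carrier → Point K n
  line x y η i = x i + η * (y i - x i)

  slack-line : ∀ x y η i j l →
    slack (line x y η) i j l ≈ slack x i j l + η * (slack y i j l - slack x i j l)
  slack-line x y η i j l = solve 7 (λ a b c p q r t →
      (a :+ t :* (p :- a)) :+ (b :+ t :* (q :- b)) :- (c :+ t :* (r :- c)) :=
      (a :+ b :- c) :+ t :* ((p :+ q :- r) :- (a :+ b :- c)))
    refl (x i) (x j) (x l) (y i) (y j) (y l) η

  dot-line : ∀ u x y η → dot K u (line x y η) ≈ dot K u x + η * (dot K u y - dot K u x)
  dot-line u x y η = begin
    sum (λ i → u i * line x y η i)
      ≈⟨ sum-cong-≋ (λ i → solve 4 (λ u x y t → u :* (x :+ t :* (y :- x)) :=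
            t :* (u :* y) :+ (con (+ 1) :- t) :* (u :* x)) refl (u i) (x i) (y i) η) ⟩
    sum (λ i → η * (u i * y i) + (ℤ⟦ + 1 ⟧ - η) * (u i * x i))
      ≈⟨ ∑-distrib-+ (λ i → η * (u i * y i)) (λ i → (ℤ⟦ + 1 ⟧ - η) * (u i * x i)) ⟩
    sum (λ i → η * (u i * y i)) + sum (λ i → (ℤ⟦ + 1 ⟧ - η) * (u i * x i))
      ≈⟨ +-cong (*-distribˡ-sum η (λ i → u i * y i)) (*-distribˡ-sum (ℤ⟦ + 1 ⟧ - η) (λ i → u i * x i)) ⟨
    η * Y + (ℤ⟦ + 1 ⟧ - η) * X
      ≈⟨ solve 3 (λ x y t → t :* y :+ (con (+ 1) :- t) :* x := x :+ t :* (y :- x)) refl X Y η ⟩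
    X + η * (Y - X) ∎
    where X = dot K u x ; Y = dot K u y

  line∈span : ∀ {q} {F : Pred (Point K n) q} {x y} → x ∈ F → y ∈ F → ∀ η → line x y η ∈ AffineSpan K F
  line∈span {x = x} {y} x∈F y∈F η =
    2 , (x ∷ y ∷ []) , (λ { zero → x∈F ; (suc zero) → y∈F }) , ((1# - η) ∷ η ∷ []) ,
    solve 2 (λ o t → o :- t :+ (t :+ con (+ 0)) := o) refl 1# η ,
    λ i → begin
      x i + η * (y i - x i)
        ≈⟨ solve 4 (λ o x y t → x :+ t :* (y :- x) := x :- t :* x :+ (t :* y :+ con (+ 0))) refl 1# (x i) (y i) η ⟩
      x i - η * x i + (η * y i + 0#)
        ≈⟨ +-congʳ (+-congʳ (*-identityˡ (x i))) ⟨
      1# * x i - η * x i + (η * y i + 0#)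
        ≈⟨ +-congʳ (solve 3 (λ o x t → o :* x :- t :* x := (o :- t) :* x) refl 1# (x i) η) ⟩
      (1# - η) * x i + (η * y i + 0#) ∎

  span⊆tight : ∀ {q} {F : Pred (Point K n) q} {w} → F ⊆ TightSpace w → AffineSpan K F ⊆ TightSpace w
  span⊆tight F⊆ {x} (r , v , v∈F , t , _ , x≈) i j l C tight = begin
    x l                                        ≈⟨ x≈ l ⟩
    sum (λ a → t a * v a l)                    ≈⟨ sum-cong-≋ (λ a → trans (*-congˡ (F⊆ (v∈F a) i j l C tight)) (distribˡ _ _ _)) ⟩
    sum (λ a → t a * v a i + t a * v a j)      ≈⟨ ∑-distrib-+ (λ a → t a * v a i) (λ a → t a * v a j) ⟩
    sum (λ a → t a * v a i) + sum (λ a → t a * v a j) ≈⟨ +-cong (x≈ i) (x≈ j) ⟨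
    x i + x j                                  ∎

  module _ {q} {F : Pred (Point K n) q} (isFace : IsFace K (GroupCone K m) F)
           {w : Point K n} (w∈ri : w ∈ RelativeInterior K F) where
    private
      u = proj₁ isFace
      b = proj₁ (proj₂ isFace)
      b≤ = proj₁ (proj₂ (proj₂ isFace))
      F⊆ = proj₁ (proj₂ (proj₂ (proj₂ isFace)))
      ⊆F = proj₂ (proj₂ (proj₂ (proj₂ isFace)))
      w∈F = proj₁ w∈ri
      ε = proj₁ (proj₂ w∈ri)
      0<ε = proj₁ (proj₂ (proj₂ w∈ri))
      ball = proj₂ (proj₂ (proj₂ w∈ri))

    0≤slack : ∀ {x} → x ∈ GroupCone K m → ∀ i j l →
              (residue i ℕ.+ residue j) % m ≡ residue l → 0# ≤ slack x i j l
    0≤slack x∈P i j l C = ≤⇒0≤- (x∈P i j l C)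

    -- Prolong the segment from y to w slightly beyond w; relative interiority keeps the end point z
    -- in `F`. A slack that vanishes at w takes values of opposite sign at y and z, and neither may
    -- be negative.
    face⊆tight : F ⊆ TightSpace w
    face⊆tight {y} y∈F i j l C tight
      with eventually-∀ (λ i → eventually-× (eventually-*< 0<ε (y i - w i)) (eventually-*< 0<ε (- (y i - w i))))
    ... | η , 0<η , small = slack≈0⁻¹ i j l (*-cancelˡ-0 0<η
            (0≤∧0≤-⇒≈0 0≤ηy (≤-respʳ slackz (0≤slack (proj₁ (F⊆ z∈F)) i j l C))))
      where
      z = line w y (- η)
      z∈F : z ∈ F
      z∈F = ball (line∈span w∈F y∈F (- η)) λ i →
        <-respˡ (solve 3 (λ x y t → t :* (:- (y :- x)) := x :+ (:- t) :* (y :- x) :- x) refl (w i) (y i) η)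
          (proj₂ (small 0<η (inj₂ refl) i)) ,
        <-respˡ (solve 3 (λ x y t → t :* (y :- x) := x :- (x :+ (:- t) :* (y :- x))) refl (w i) (y i) η)
          (proj₁ (small 0<η (inj₂ refl) i))
      0≤ηy : 0# ≤ η * slack y i j l
      0≤ηy with 0≤slack (proj₁ (F⊆ y∈F)) i j l C
      ... | inj₁ p = inj₁ (*-pos 0<η p)
      ... | inj₂ p = inj₂ (sym (trans (*-congˡ (sym p)) (zeroʳ η)))
      slackz : slack z i j l ≈ - (η * slack y i j l)
      slackz = begin
        slack z i j l   ≈⟨ slack-line w y (- η) i j l ⟩
        W + - η * (Y - W) ≈⟨ solve 3 (λ x y t → x :+ (:- t) :* (y :- x) := :- (t :* y) :+ (x :+ t :* x)) refl W Y η ⟩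
        - (η * Y) + (W + η * W) ≈⟨ +-congˡ (+-cong W≈0 (trans (*-congˡ W≈0) (zeroʳ η))) ⟩
        - (η * Y) + (0# + 0#) ≈⟨ trans (+-congˡ (+-identityˡ 0#)) (+-identityʳ _) ⟩
        - (η * Y) ∎
        where W = slack w i j l ; Y = slack y i j l
              W≈0 = slack≈0 {w} i j l tight

    -- Along the line from w towards a point of the tight space, the slacks that vanish at w stay
    -- zero, and the positive ones stay positive for a short while in both directions.
    eventually-cone : ∀ {x} → x ∈ TightSpace w →
      Eventually (λ η → line w x η ∈ GroupCone K m × line w x (- η) ∈ GroupCone K m)
    eventually-cone {x} x∈L = proj₁ ev , proj₁ (proj₂ ev) , λ 0<θ θ≤ →
      (λ i j l C → 0≤-⇒≤ (proj₁ (proj₂ (proj₂ ev) 0<θ θ≤ i j l C))) ,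
      (λ i j l C → 0≤-⇒≤ (proj₂ (proj₂ (proj₂ ev) 0<θ θ≤ i j l C)))
      where
      Good : Fin n → Fin n → Fin n → Carrier → Set _
      Good i j l η = (residue i ℕ.+ residue j) % m ≡ residue l →
        0# ≤ slack (line w x η) i j l × 0# ≤ slack (line w x (- η)) i j l
      -- A negative slack contradicts membership of `w` in the cone only for triples with i + j ≡ l,
      -- which is why `Good` carries that congruence as a premise.
      negative : ∀ {i j l} → ¬ (0# ≤ slack w i j l) → Eventually (Good i j l)
      negative ¬p = 1# , 0<1 , λ _ _ C → contradiction (0≤slack (proj₁ (F⊆ w∈F)) _ _ _ C) ¬p
      zero-slack : ∀ i j l → slack w i j l ≈ 0# → ∀ θ →
        (residue i ℕ.+ residue j) % m ≡ residue l → slack (line w x θ) i j l ≈ 0#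
      zero-slack i j l W≈0 θ C = begin
        slack (line w x θ) i j l ≈⟨ slack-line w x θ i j l ⟩
        W + θ * (X - W)          ≈⟨ +-cong W≈0 (*-congˡ (trans (+-cong X≈0 (-‿cong W≈0)) (-‿inverseʳ 0#))) ⟩
        0# + θ * 0#              ≈⟨ trans (+-identityˡ _) (zeroʳ θ) ⟩
        0#                       ∎
        where W = slack w i j l ; X = slack x i j l
              X≈0 = slack≈0 {x} i j l (x∈L i j l C (slack≈0⁻¹ {w} i j l W≈0))
      good : ∀ i j l → Eventually (Good i j l)
      good i j l with compare (slack w i j l) 0#
      ... | tri< W<0 _ _ = negative λ
            { (inj₁ 0<W) → contradiction (<-trans 0<W W<0) (irrefl refl)
            ; (inj₂ 0≈W) → contradiction W<0 (irrefl (sym 0≈W)) }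
      ... | tri≈ _ W≈0 _ = 1# , 0<1 , λ {θ} _ _ C →
            inj₂ (sym (zero-slack i j l W≈0 θ C)) , inj₂ (sym (zero-slack i j l W≈0 (- θ) C))
      ... | tri> _ _ 0<W with eventually-× (eventually-*< 0<W (- (slack x i j l - slack w i j l)))
                                            (eventually-*< 0<W (slack x i j l - slack w i j l))
      ... | η , 0<η , small = η , 0<η , λ {θ} 0<θ θ≤ _ →
            inj₁ (<-respʳ (trans (solve 3 (λ a b t → a :- t :* (:- (b :- a)) := a :+ t :* (b :- a)) refl _ _ θ)
                             (sym (slack-line w x θ i j l)))
                   (<⇒0<- (proj₁ (small 0<θ θ≤)))) ,
            inj₁ (<-respʳ (trans (solve 3 (λ a b t → a :- t :* (b :- a) := a :+ (:- t) :* (b :- a)) refl _ _ θ)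
                             (sym (slack-line w x (- θ) i j l)))
                   (<⇒0<- (proj₂ (small 0<θ θ≤))))
      ev = eventually-∀ (λ i → eventually-∀ (λ j → eventually-∀ (λ l → good i j l)))

    -- The functional of the face attains its minimum `b` at w. Since the points at ±η both lie in
    -- the cone, its variation ηD and the opposite -ηD are nonnegative, so the point y at η lies in
    -- `F`. Then x lies on the line through w and y, at parameter η⁻¹.
    tight⊆span : TightSpace w ⊆ AffineSpan K F
    tight⊆span {x} x∈L with eventually-cone x∈L
    ... | η , 0<η , cone with pos-inverse 0<η
    ... | η⁻¹ , _ , ηη⁻¹≈1 =
      let (r , v , v∈F , t , Σt≈1 , eq) = line∈span {F = F} w∈F y∈F η⁻¹ in
      r , v , v∈F , t , Σt≈1 , λ i → trans (x≈line i) (eq i)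
      where
      y = line w x η
      D = dot K u x - dot K u w
      uw≈b : dot K u w ≈ b
      uw≈b = proj₂ (F⊆ w∈F)
      side : ∀ θ → line w x θ ∈ GroupCone K m → 0# ≤ θ * D
      side θ ∈P = ≤-respʳ (begin
        dot K u (line w x θ) - b         ≈⟨ +-cong (dot-line u w x θ) (-‿cong (sym uw≈b)) ⟩
        dot K u w + θ * D - dot K u w    ≈⟨ solve 2 (λ a b → a :+ b :- a := b) refl (dot K u w) (θ * D) ⟩
        θ * D                            ∎) (≤⇒0≤- (b≤ ∈P))
      ηD≈0 : η * D ≈ 0#
      ηD≈0 = 0≤∧0≤-⇒≈0 (side η (proj₁ (cone 0<η (inj₂ refl))))
        (≤-respʳ (solve 2 (λ t d → (:- t) :* d := :- (t :* d)) refl η D)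
          (side (- η) (proj₂ (cone 0<η (inj₂ refl)))))
      y∈F : y ∈ F
      y∈F = ⊆F (proj₁ (cone 0<η (inj₂ refl)) , (begin
        dot K u y          ≈⟨ dot-line u w x η ⟩
        dot K u w + η * D  ≈⟨ +-cong uw≈b ηD≈0 ⟩
        b + 0#             ≈⟨ +-identityʳ b ⟩
        b                  ∎))
      x≈line : ∀ i → x i ≈ line w y η⁻¹ i
      x≈line i = begin
        x i ≈⟨ solve 2 (λ w x → x := w :+ (x :- w)) refl (w i) (x i) ⟩
        w i + (x i - w i) ≈⟨ +-congˡ (trans (*-congʳ ηη⁻¹≈1) (*-identityˡ _)) ⟨
        w i + η * η⁻¹ * (x i - w i) ≈⟨ solve 4 (λ w x t s → w :+ t :* s :* (x :- w) :=
             w :+ s :* (w :+ t :* (x :- w) :- w)) refl (w i) (x i) η η⁻¹ ⟩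
        w i + η⁻¹ * (w i + η * (x i - w i) - w i) ∎

  -- The origin joined to a basis of `L` is an affine basis. The origin contributes nothing to any
  -- coordinate, so its weight is free to bring the sum of the weights to 1; the coordinates picked
  -- by `p` read off the remaining weights.
  coordinates⇒dimension : ∀ {q ℓ e} {F : Pred (Point K n) q} {L : Pred (Point K n) ℓ} →
    AffineSpan K F ⊆ L → L ⊆ AffineSpan K F → (λ _ → 0#) ∈ L →
    (p : Fin e → Fin n) (B : Vector (Point K n) e) →
    (∀ j → B j ∈ L) →
    (∀ i j → B j (p i) ≈ δ (toℕ j) (toℕ i)) →
    (∀ {x} → x ∈ L → ∀ i → x i ≈ sum (λ j → x (p j) * B j i)) →
    HasDimension K F e
  coordinates⇒dimension {e = e} ⊆L L⊆ 0∈L p B B∈L dual expand =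
    v , independent , (λ { zero → L⊆ 0∈L ; (suc j) → L⊆ (B∈L j) }) , λ x∈ → combination (⊆L x∈)
    where
    v : Vector (Point K n) (suc e)
    v = (λ _ → 0#) ∷ B
    independent : AffinelyIndependent K v
    independent t Σt≈0 Σtv≈0 = λ { zero → t₀≈0 ; (suc j) → tⱼ≈0 j }
      where
      tⱼ≈0 : ∀ j → t (suc j) ≈ 0#
      tⱼ≈0 j = begin
        t (suc j)                                ≈⟨ sum-*δ (λ i → t (suc i)) j ⟨
        sum (λ i → t (suc i) * δ (toℕ i) (toℕ j)) ≈⟨ sum-cong-≋ (λ i → *-congˡ (dual j i)) ⟨
        sum (λ i → t (suc i) * B i (p j))        ≈⟨ +-identityˡ _ ⟨
        0# + sum (λ i → t (suc i) * B i (p j))   ≈⟨ +-congʳ (zeroʳ (t zero)) ⟨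
        sum (λ i → t i * v i (p j))              ≈⟨ Σtv≈0 (p j) ⟩
        0#                                       ∎
      t₀≈0 : t zero ≈ 0#
      t₀≈0 = begin
        t zero                            ≈⟨ +-identityʳ _ ⟨
        t zero + 0#                       ≈⟨ +-congˡ (sum≈0 _ tⱼ≈0) ⟨
        t zero + sum (λ j → t (suc j))    ≈⟨ Σt≈0 ⟩
        0#                                ∎
    combination : ∀ {x} → _ → IsAffineCombination K v x
    combination {x} x∈L = ((1# - s) ∷ (λ j → x (p j))) ,
      solve 2 (λ o s → o :- s :+ s := o) refl 1# s ,
      λ i → begin
        x i                                       ≈⟨ expand x∈L i ⟩
        sum (λ j → x (p j) * B j i)               ≈⟨ +-identityˡ _ ⟨
        0# + sum (λ j → x (p j) * B j i)          ≈⟨ +-congʳ (zeroʳ (1# - s)) ⟨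
        (1# - s) * 0# + sum (λ j → x (p j) * B j i) ∎
      where s = sum (λ j → x (p j))

-- Functions that are additive wherever the ceiling is

module AdditiveFunctions {c ℓ₁ ℓ₂} (K : OrderedField c ℓ₁ ℓ₂) where
  open FieldProperties K
  open import Relation.Binary.Reasoning.Setoid setoid

  -- Only the values of X at 1, …, a - 1 matter.
  CeilingAdditive : (a k : ℕ) → (ℕ → Carrier) → Set _
  CeilingAdditive a k X = ∀ {s t} → 1 ℕ.≤ s → 1 ℕ.≤ t → s ℕ.+ t ℕ.< a →
    ⌈ s /1+ k ⌉ ℕ.+ ⌈ t /1+ k ⌉ ≡ ⌈ s ℕ.+ t /1+ k ⌉ → X (s ℕ.+ t) ≈ X s + X t

  record Coordinates (a k e : ℕ) : Set (c ⊔ ℓ₁) where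
    field
      e<a      : e ℕ.< a
      basis    : Fin e → ℕ → Carrier
      additive : ∀ j → CeilingAdditive a k (basis j)
      dual     : ∀ (i j : Fin e) → basis j (residue i) ≈ δ (toℕ j) (toℕ i)
      expand   : ∀ {X} → CeilingAdditive a k X → ∀ {s} → 1 ℕ.≤ s → s ℕ.< a →
                 X s ≈ sum (λ j → X (residue j) * basis j s)

  sum-*δ-ℕ : ∀ {e} (Y : ℕ → Carrier) {s} → s ℕ.< e → sum {e} (λ j → Y (toℕ j) * δ (toℕ j) s) ≈ Y s
  sum-*δ-ℕ {e} Y {s} s<e = ≡.subst (λ s → sum {e} (λ j → Y (toℕ j) * δ (toℕ j) s) ≈ Y s)
    (toℕ-fromℕ< s<e) (sum-*δ (λ j → Y (toℕ j)) (fromℕ< s<e))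

  -- All numbers from 1 to `suc k` have ceiling 1, and 1 + 1 ≠ 1. Hence there are no relations, and
  -- the indicator functions form the basis.
  full-coordinates : ∀ k → Coordinates (2 ℕ.+ k) k (suc k)
  full-coordinates k = record
    { e<a      = ℕ.≤-refl
    ; basis    = λ j s → δ (toℕ j) (s ∸ 1)
    ; additive = λ j {s} {t} 1≤s 1≤t s+t<a c≡ → ⊥-elim (impossible 1≤s 1≤t (ℕ.≤-pred s+t<a) c≡)
    ; dual     = λ i j → refl
    ; expand   = λ { {X} _ {suc s} _ (s≤s s<e) → sym (sum-*δ-ℕ (λ s → X (suc s)) s<e) }
    }
    where
    impossible : ∀ {s t} → 1 ℕ.≤ s → 1 ℕ.≤ t → s ℕ.+ t ℕ.≤ suc k →
      ⌈ s /1+ k ⌉ ℕ.+ ⌈ t /1+ k ⌉ ≡ ⌈ s ℕ.+ t /1+ k ⌉ → ⊥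
    impossible {s} {t} 1≤s 1≤t s+t≤ c≡
      with () ← ≡.trans (≡.sym (≡.cong₂ ℕ._+_ (⌈/⌉-small {k} 1≤s (ℕ.≤-trans (ℕ.m≤m+n s t) s+t≤))
                                            (⌈/⌉-small {k} 1≤t (ℕ.≤-trans (ℕ.m≤n+m t s) s+t≤))))
                (≡.trans c≡ (⌈/⌉-small {k} (ℕ.≤-trans 1≤s (ℕ.m≤m+n s t)) s+t≤))

  fromℕ-+ : ∀ m n → fromℕ K (m ℕ.+ n) ≈ fromℕ K m + fromℕ K n
  fromℕ-+ = ×-homo-+ 1#

  -- For divisor 1 the ceiling is the identity, so every sum below `a` is a relation and X(s) =
  -- sX(1).
  line-coordinates : ∀ a → 1 ℕ.< a → Coordinates a 0 1
  line-coordinates a 1<a = record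
    { e<a      = 1<a
    ; basis    = λ _ → fromℕ K
    ; additive = λ _ {s} {t} _ _ _ _ → fromℕ-+ s t
    ; dual     = λ { zero zero → +-identityʳ 1# }
    ; expand   = λ { {X} X-additive {suc s} _ s<a → trans (multiple X-additive s s<a) (sym (+-identityʳ _)) }
    }
    where
    ⌈/1⌉ : ∀ s → ⌈ s /1+ 0 ⌉ ≡ s
    ⌈/1⌉ s = ≡.trans (n/1≡n (s ℕ.+ 0)) (ℕ.+-identityʳ s)
    multiple : ∀ {X} → CeilingAdditive a 0 X → ∀ s → suc s ℕ.< a → X (suc s) ≈ X 1 * fromℕ K (suc s)
    multiple {X} _ zero _ = sym (trans (*-congˡ (+-identityʳ 1#)) (*-identityʳ (X 1)))
    multiple {X} X-additive (suc s) s<a = begin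
      X (1 ℕ.+ suc s)                     ≈⟨ X-additive (s≤s z≤n) (s≤s z≤n) s<a
                                              (≡.trans (≡.cong₂ ℕ._+_ (⌈/1⌉ 1) (⌈/1⌉ (suc s))) (≡.sym (⌈/1⌉ (2 ℕ.+ s)))) ⟩
      X 1 + X (suc s)                     ≈⟨ +-cong (sym (*-identityʳ (X 1))) (multiple X-additive s (ℕ.<-trans (ℕ.n<1+n _) s<a)) ⟩
      X 1 * 1# + X 1 * fromℕ K (suc s)    ≈⟨ distribˡ (X 1) 1# (fromℕ K (suc s)) ⟨
      X 1 * fromℕ K (2 ℕ.+ s)             ∎

  -- Comparing the decompositions of X(κ + 1) and X(κ + 2) into values at arguments ≤ κ shows
  -- that X(1), …, X(κ) is an arithmetic progression.
  plane-coordinates : ∀ a k → 4 ℕ.+ k ℕ.< a → Coordinates a (suc k) 2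
  plane-coordinates a k 4+k<a = record
    { e<a      = ℕ.≤-<-trans (s≤s (s≤s z≤n)) 4+k<a
    ; basis    = B
    ; additive = B-additive
    ; dual     = B-dual
    ; expand   = λ { {X} X-additive {suc s} _ s<a → expand X-additive s s<a }
    }
    where
    κ = 2 ℕ.+ k
    C : ℕ → Carrier
    C s = fromℕ K ⌈ s /1+ suc k ⌉
    I : ℕ → Carrier
    I = fromℕ K
    C-additive : ∀ {s t} → ⌈ s /1+ suc k ⌉ ℕ.+ ⌈ t /1+ suc k ⌉ ≡ ⌈ s ℕ.+ t /1+ suc k ⌉ → C (s ℕ.+ t) ≈ C s + C t
    C-additive {s} {t} c≡ = trans (reflexive (≡.cong (fromℕ K) (≡.sym c≡))) (fromℕ-+ ⌈ s /1+ suc k ⌉ ⌈ t /1+ suc k ⌉)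
    -- The ceiling and the identity are two evident solutions. They take the values (1, 1) at 1 and
    -- (1, 2) at 2, and these are the combinations dual to evaluation at 1 and 2.
    B : Fin 2 → ℕ → Carrier
    B zero       s = C s + C s - I s
    B (suc zero) s = I s - C s
    B-additive : ∀ j → CeilingAdditive a (suc k) (B j)
    B-additive zero {s} {t} _ _ _ c≡ = trans
      (+-cong (+-cong (C-additive {s} {t} c≡) (C-additive {s} {t} c≡)) (-‿cong (fromℕ-+ s t)))
      (solve 4 (λ x y u v → x :+ y :+ (x :+ y) :- (u :+ v) := x :+ x :- u :+ (y :+ y :- v)) refl (C s) (C t) (I s) (I t))
    B-additive (suc zero) {s} {t} _ _ _ c≡ = trans
      (+-cong (fromℕ-+ s t) (-‿cong (C-additive {s} {t} c≡)))
      (solve 4 (λ x y u v → u :+ v :- (x :+ y) := u :- x :+ (v :- y)) refl (C s) (C t) (I s) (I t))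
    c1 : ⌈ 1 /1+ suc k ⌉ ≡ 1
    c1 = ⌈/⌉-small {suc k} (s≤s z≤n) (s≤s z≤n)
    c2 : ⌈ 2 /1+ suc k ⌉ ≡ 1
    c2 = ⌈/⌉-small {suc k} (s≤s z≤n) (s≤s (s≤s z≤n))
    B-dual : ∀ (i j : Fin 2) → B j (residue i) ≈ δ (toℕ j) (toℕ i)
    B-dual zero       zero       = trans (+-congʳ (+-cong (reflexive (≡.cong I c1)) (reflexive (≡.cong I c1))))
      (solve 1 (λ o → o :+ con (+ 0) :+ (o :+ con (+ 0)) :- (o :+ con (+ 0)) := o) refl 1#)
    B-dual (suc zero) zero       = trans (+-congʳ (+-cong (reflexive (≡.cong I c2)) (reflexive (≡.cong I c2))))
      (solve 1 (λ o → o :+ con (+ 0) :+ (o :+ con (+ 0)) :- (o :+ (o :+ con (+ 0))) := con (+ 0)) refl 1#)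
    B-dual zero       (suc zero) = trans (+-congˡ (-‿cong (reflexive (≡.cong I c1)))) (-‿inverseʳ (1# + 0#))
    B-dual (suc zero) (suc zero) = trans (+-congˡ (-‿cong (reflexive (≡.cong I c2))))
      (solve 1 (λ o → o :+ (o :+ con (+ 0)) :- (o :+ con (+ 0)) := o) refl 1#)

    module _ {X : ℕ → Carrier} (X-additive : CeilingAdditive a (suc k) X) where
      D = X 2 - X 1

      -- For u = 1 or 2 the ceiling of u + κ is 2, while arguments from 1 to κ have ceiling 1; every
      -- such decomposition is therefore a relation. The assumption on `a` keeps κ + 2 inside the
      -- interval.
      split : ∀ {s t u} → 1 ℕ.≤ s → s ℕ.≤ κ → 1 ℕ.≤ t → t ℕ.≤ κ → 1 ℕ.≤ u → u ℕ.≤ 2 → s ℕ.+ t ≡ u ℕ.+ κ →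
              X (u ℕ.+ κ) ≈ X s + X t
      split {s} {t} {u} 1≤s s≤κ 1≤t t≤κ 1≤u u≤2 s+t≡ = ≡.subst (λ v → X v ≈ X s + X t) s+t≡
        (X-additive 1≤s 1≤t (≡.subst (ℕ._< a) (≡.sym s+t≡) (ℕ.≤-<-trans (ℕ.+-monoˡ-≤ κ u≤2) 4+k<a))
          (≡.trans (≡.cong₂ ℕ._+_ (⌈/⌉-small {suc k} 1≤s s≤κ) (⌈/⌉-small {suc k} 1≤t t≤κ))
            (≡.sym (≡.trans (≡.cong ⌈_/1+ suc k ⌉ s+t≡) (≡.trans (⌈/⌉-+ (suc k) u)
              (≡.cong suc (⌈/⌉-small {suc k} 1≤u (ℕ.≤-trans u≤2 (s≤s (s≤s z≤n))))))))))

      -- With j = κ - i, both X(i + 2) + X(j) = X(2) + X(κ) and X(i + 1) + X(j) = X(1) + X(κ) hold;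
      -- subtract.
      step : ∀ i → suc (suc i) ℕ.≤ κ → X (suc (suc i)) ≈ X (suc i) + D
      step i 2+i≤κ = begin
        X (2 ℕ.+ i)                       ≈⟨ solve 2 (λ x y → x := x :+ y :- y) refl (X (2 ℕ.+ i)) (X j) ⟩
        X (2 ℕ.+ i) + X j - X j           ≈⟨ +-congʳ (split (s≤s z≤n) 2+i≤κ 1≤j j≤κ (s≤s z≤n) (s≤s (s≤s z≤n)) (≡.cong (2 ℕ.+_) i+j≡)) ⟨
        X (2 ℕ.+ κ) - X j                 ≈⟨ +-congʳ (split (s≤s z≤n) (s≤s (s≤s z≤n)) (s≤s z≤n) ℕ.≤-refl (s≤s z≤n) (s≤s (s≤s z≤n)) ≡.refl) ⟩
        X 2 + X κ - X j                   ≈⟨ solve 4 (λ x y z w → y :+ z :- w := x :+ z :- w :+ (y :- x)) refl (X 1) (X 2) (X κ) (X j) ⟩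
        X 1 + X κ - X j + D               ≈⟨ +-congʳ (+-congʳ (split (s≤s z≤n) (s≤s z≤n) (s≤s z≤n) ℕ.≤-refl (s≤s z≤n) (s≤s z≤n) ≡.refl)) ⟨
        X (1 ℕ.+ κ) - X j + D             ≈⟨ +-congʳ (+-congʳ (split (s≤s z≤n) (ℕ.<⇒≤ 2+i≤κ) 1≤j j≤κ (s≤s z≤n) (s≤s z≤n) (≡.cong suc i+j≡))) ⟩
        X (1 ℕ.+ i) + X j - X j + D       ≈⟨ +-congʳ (solve 2 (λ x y → x :+ y :- y := x) refl (X (1 ℕ.+ i)) (X j)) ⟩
        X (1 ℕ.+ i) + D                   ∎
        where
        j = κ ∸ i
        i≤κ : i ℕ.≤ κ
        i≤κ = ℕ.≤-trans (ℕ.m≤n+m i 2) 2+i≤κ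
        i+j≡ : i ℕ.+ j ≡ κ
        i+j≡ = ℕ.m+[n∸m]≡n i≤κ
        1≤j : 1 ℕ.≤ j
        1≤j = ℕ.m<n⇒0<n∸m (ℕ.<⇒≤ 2+i≤κ)
        j≤κ : j ℕ.≤ κ
        j≤κ = ℕ.m∸n≤m κ i

      progression : ∀ i → suc i ℕ.≤ κ → X (suc i) ≈ X 1 + I i * D
      progression zero    _    = sym (trans (+-congˡ (zeroˡ D)) (+-identityʳ (X 1)))
      progression (suc i) i<κ  = begin
        X (2 ℕ.+ i)                ≈⟨ step i i<κ ⟩
        X (suc i) + D              ≈⟨ +-congʳ (progression i (ℕ.<⇒≤ i<κ)) ⟩
        X 1 + I i * D + D          ≈⟨ +-congˡ (*-identityˡ D) ⟨
        X 1 + I i * D + 1# * D     ≈⟨ solve 4 (λ x i d o → x :+ i :* d :+ o :* d := x :+ (o :+ i) :* d) refl (X 1) (I i) D 1# ⟩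
        X 1 + I (suc i) * D        ∎

      -- Adding κ raises the ceiling by exactly 1, the ceiling of κ, so each such step is a
      -- relation.
      periodic : ∀ i t → i ℕ.< κ → suc (i ℕ.+ t ℕ.* κ) ℕ.< a → X (suc (i ℕ.+ t ℕ.* κ)) ≈ X (suc i) + I t * X κ
      periodic i zero    _   _  = trans (reflexive (≡.cong X (≡.cong suc (ℕ.+-identityʳ i))))
        (sym (trans (+-congˡ (zeroˡ (X κ))) (+-identityʳ _)))
      periodic i (suc t) i<κ <a = begin
        X (suc (i ℕ.+ suc t ℕ.* κ))            ≡⟨ ≡.cong X s≡ ⟩
        X (s ℕ.+ κ)                            ≈⟨ X-additive (s≤s z≤n) (s≤s z≤n) (≡.subst (ℕ._< a) s≡ <a) c≡ ⟩
        X s + X κ                              ≈⟨ +-cong (periodic i t i<κ (ℕ.≤-<-trans (≡.subst (s ℕ.≤_) (≡.sym s≡) (ℕ.m≤m+n s κ)) <a)) (sym (*-identityˡ (X κ))) ⟩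
        X (suc i) + I t * X κ + 1# * X κ       ≈⟨ solve 4 (λ x i d o → x :+ i :* d :+ o :* d := x :+ (o :+ i) :* d) refl (X (suc i)) (I t) (X κ) 1# ⟩
        X (suc i) + I (suc t) * X κ            ∎
        where
        s = suc (i ℕ.+ t ℕ.* κ)
        s≡ : suc (i ℕ.+ suc t ℕ.* κ) ≡ s ℕ.+ κ
        s≡ = ≡.cong suc (≡.trans (≡.cong (i ℕ.+_) (ℕ.+-comm κ (t ℕ.* κ))) (≡.sym (ℕ.+-assoc i (t ℕ.* κ) κ)))
        c≡ : ⌈ s /1+ suc k ⌉ ℕ.+ ⌈ κ /1+ suc k ⌉ ≡ ⌈ s ℕ.+ κ /1+ suc k ⌉
        c≡ = ≡.trans (≡.cong (⌈ s /1+ suc k ⌉ ℕ.+_) (⌈/⌉-small {suc k} (s≤s z≤n) ℕ.≤-refl))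
               (≡.trans (ℕ.+-comm _ 1) (≡.sym (⌈/⌉-+ (suc k) s)))

      expand : ∀ s → suc s ℕ.< a → X (suc s) ≈ X 1 * B zero (suc s) + (X 2 * B (suc zero) (suc s) + 0#)
      expand s s<a = begin
        X (suc s)                             ≡⟨ ≡.cong (λ s → X (suc s)) s≡ ⟩
        X (suc (i ℕ.+ t ℕ.* κ))               ≈⟨ periodic i t i<κ (≡.subst (λ s → suc s ℕ.< a) s≡ s<a) ⟩
        X (suc i) + T * X κ                   ≈⟨ +-cong (progression i i<κ) (*-congˡ (progression (suc k) ℕ.≤-refl)) ⟩
        X 1 + I i * D + T * (X 1 + K′ * D)
          -- The factors `1#` are inserted because the solver call below treats `1#` as an
          -- indeterminate and needs both sides homogeneous in it.
          ≈⟨ +-congʳ (+-congʳ (*-identityʳ (X 1))) ⟨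
        X 1 * 1# + I i * D + T * (X 1 + K′ * D)
          ≈⟨ +-cong (+-congʳ refl) (*-congˡ (+-congʳ (*-identityʳ (X 1)))) ⟨
        X 1 * 1# + I i * D + T * (X 1 * 1# + K′ * D)
          ≈⟨ solve 6 (λ x y i t k o → x :* o :+ i :* (y :- x) :+ t :* (x :* o :+ k :* (y :- x)) :=
               x :* (o :+ t :* o :- i :- t :* k) :+ (y :* (i :+ t :* k) :+ con (+ 0))) refl (X 1) (X 2) (I i) T K′ 1# ⟩
        X 1 * (1# + T * 1# - I i - T * K′) + (X 2 * (I i + T * K′) + 0#)
          ≈⟨ +-cong (*-congˡ B₀≈) (+-congʳ (*-congˡ B₁≈)) ⟨
        X 1 * B zero (suc s) + (X 2 * B (suc zero) (suc s) + 0#) ∎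
        where
        i = s % κ
        t = s / κ
        T = I t
        K′ = I (suc k)
        s≡ : s ≡ i ℕ.+ t ℕ.* κ
        s≡ = m≡m%n+[m/n]*n s κ
        i<κ = m%n<n s κ
        C≈ : C (suc s) ≈ 1# + T
        C≈ = reflexive (≡.cong I (⌈/⌉-suc {suc k} s))
        I≈ : I (suc s) ≈ 1# + (I i + T * (1# + K′))
        I≈ = +-congˡ (trans (reflexive (≡.cong I s≡)) (trans (fromℕ-+ i (t ℕ.* κ)) (+-congˡ (×1-homo-* t κ))))
        T1≈ : T ≈ T * 1#
        T1≈ = sym (*-identityʳ T)
        B₀≈ : B zero (suc s) ≈ 1# + T * 1# - I i - T * K′
        B₀≈ = begin
          C (suc s) + C (suc s) - I (suc s)                    ≈⟨ +-cong (+-cong C≈ C≈) (-‿cong I≈) ⟩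
          1# + T + (1# + T) - (1# + (I i + T * (1# + K′)))     ≈⟨ +-congʳ (+-cong (+-congˡ T1≈) (+-congˡ T1≈)) ⟩
          1# + T * 1# + (1# + T * 1#) - (1# + (I i + T * (1# + K′)))
            ≈⟨ solve 4 (λ o t i k → o :+ t :* o :+ (o :+ t :* o) :- (o :+ (i :+ t :* (o :+ k))) := o :+ t :* o :- i :- t :* k) refl 1# T (I i) K′ ⟩
          1# + T * 1# - I i - T * K′ ∎
        B₁≈ : B (suc zero) (suc s) ≈ I i + T * K′
        B₁≈ = begin
          I (suc s) - C (suc s)                                ≈⟨ +-cong I≈ (-‿cong (trans C≈ (+-congˡ T1≈))) ⟩
          1# + (I i + T * (1# + K′)) - (1# + T * 1#)
            ≈⟨ solve 4 (λ o t i k → o :+ (i :+ t :* (o :+ k)) :- (o :+ t :* o) := i :+ t :* k) refl 1# T (I i) K′ ⟩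
          I i + T * K′ ∎

  -- The only relations are X(s) + X(T - s) = X(T) for T = a - 1, so X is determined by its
  -- values at 1, …, e as soon as T ≤ 2e.
  half-coordinates : ∀ k e e′ → e ℕ.+ e′ ≡ 2 ℕ.+ k → 1 ℕ.≤ e′ → e′ ℕ.≤ e → e ℕ.≤ suc e′ → Coordinates (3 ℕ.+ k) k e
  half-coordinates k e e′ e+e′≡T 1≤e′ e′≤e e≤1+e′ = record
    { e<a      = s≤s (ℕ.≤-trans (ℕ.m≤m+n e e′) (ℕ.≤-reflexive e+e′≡T))
    ; basis    = λ j → R (D j)
    ; additive = λ j {s} {t} 1≤s 1≤t s+t<a c≡ → R-additive (D j) refl {s} {t} 1≤s 1≤t s+t<a c≡
    ; dual     = λ i j → reflexive (R-≤ (D j) (toℕ<n i))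
    ; expand   = λ X-additive 1≤s s<a → sym (expand X-additive 1≤s (ℕ.≤-pred s<a))
    }
    where
    T = 2 ℕ.+ k
    -- Extension of values on 1, ..., e by the reflection s ↦ T - s. The sum `Y e + Y e′` is the
    -- value forced at T = e + e′; at s = T the reflection reads `Y 0`, which must then be zero.
    R : (ℕ → Carrier) → ℕ → Carrier
    R Y s with s ℕ.≤? e
    ... | yes _ = Y s
    ... | no  _ = Y e + Y e′ - Y (T ∸ s)
    -- The indicator of j + 1, with the value 0 at 0 that the reflection requires.
    D : Fin e → ℕ → Carrier
    D j zero    = 0#
    D j (suc s) = δ (toℕ j) s

    R-≤ : ∀ Y {s} → s ℕ.≤ e → R Y s ≡ Y s
    R-≤ Y {s} s≤e with s ℕ.≤? e
    ... | yes _ = ≡.refl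
    ... | no ¬p = contradiction s≤e ¬p

    R-> : ∀ Y {s} → e ℕ.< s → R Y s ≡ Y e + Y e′ - Y (T ∸ s)
    R-> Y {s} e<s with s ℕ.≤? e
    ... | yes p = contradiction p (ℕ.<⇒≱ e<s)
    ... | no _  = ≡.refl

    e<T : e ℕ.< T
    e<T = ≡.subst (e ℕ.<_) e+e′≡T (ℕ.≤-trans (ℕ.≤-reflexive (ℕ.+-comm 1 e)) (ℕ.+-monoʳ-≤ e 1≤e′))

    1≤e : 1 ℕ.≤ e
    1≤e = ℕ.≤-trans 1≤e′ e′≤e

    s+t≡T⇒s≤k : ∀ {s t} → 1 ℕ.≤ t → s ℕ.+ t ℕ.≤ T → s ℕ.≤ suc k
    s+t≡T⇒s≤k {s} {t} 1≤t s+t≤T = ℕ.≤-pred (ℕ.≤-trans (ℕ.≤-reflexive (ℕ.+-comm 1 s)) (ℕ.≤-trans (ℕ.+-monoʳ-≤ s 1≤t) s+t≤T))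

    -- Below T all the ceilings involved are 1, and 1 + 1 ≠ 1.
    sum-is-T : ∀ {s t} → 1 ℕ.≤ s → 1 ℕ.≤ t → s ℕ.+ t ℕ.< suc T →
      ⌈ s /1+ k ⌉ ℕ.+ ⌈ t /1+ k ⌉ ≡ ⌈ s ℕ.+ t /1+ k ⌉ → s ℕ.+ t ≡ T
    sum-is-T {s} {t} 1≤s 1≤t (s≤s s+t≤T) c≡ with ℕ.m≤n⇒m<n∨m≡n s+t≤T
    ... | inj₂ s+t≡T = s+t≡T
    ... | inj₁ (s≤s s+t≤1+k)
      with () ← ≡.trans (≡.sym (≡.cong₂ ℕ._+_ (⌈/⌉-small {k} 1≤s (ℕ.≤-trans (ℕ.m≤m+n s t) s+t≤1+k))
                                            (⌈/⌉-small {k} 1≤t (ℕ.≤-trans (ℕ.m≤n+m t s) s+t≤1+k))))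
                (≡.trans c≡ (⌈/⌉-small {k} (ℕ.≤-trans 1≤s (ℕ.m≤m+n s t)) s+t≤1+k))

    ceilings-add : ∀ {s t} → 1 ℕ.≤ s → 1 ℕ.≤ t → s ℕ.+ t ≡ T → ⌈ s /1+ k ⌉ ℕ.+ ⌈ t /1+ k ⌉ ≡ ⌈ s ℕ.+ t /1+ k ⌉
    ceilings-add {s} {t} 1≤s 1≤t s+t≡T =
      ≡.trans (≡.cong₂ ℕ._+_ (⌈/⌉-small {k} 1≤s (s+t≡T⇒s≤k 1≤t (ℕ.≤-reflexive s+t≡T)))
                             (⌈/⌉-small {k} 1≤t (s+t≡T⇒s≤k 1≤s (ℕ.≤-reflexive (≡.trans (ℕ.+-comm t s) s+t≡T)))))
        (≡.sym (≡.trans (≡.cong ⌈_/1+ k ⌉ s+t≡T) (≡.trans (⌈/⌉-+ k 1) (≡.cong suc (⌈/⌉-small {k} (s≤s z≤n) (s≤s z≤n))))))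

    module _ (Y : ℕ → Carrier) (Y0≈0 : Y 0 ≈ 0#) where
      R-T : R Y T ≈ Y e + Y e′
      R-T = begin
        R Y T                     ≡⟨ R-> Y e<T ⟩
        Y e + Y e′ - Y (T ∸ T)    ≡⟨ ≡.cong (λ r → Y e + Y e′ - Y r) (ℕ.n∸n≡0 T) ⟩
        Y e + Y e′ - Y 0          ≈⟨ +-congˡ (trans (-‿cong Y0≈0) (solve 0 (:- con (+ 0) := con (+ 0)) refl)) ⟩
        Y e + Y e′ + 0#           ≈⟨ +-identityʳ _ ⟩
        Y e + Y e′                ∎

      R-mixed : ∀ {s t} → s ℕ.+ t ≡ T → s ℕ.≤ e → e ℕ.< t → R Y T ≈ R Y s + R Y t
      R-mixed {s} {t} s+t≡T s≤e e<t = begin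
        R Y T                                 ≈⟨ R-T ⟩
        Y e + Y e′                            ≈⟨ solve 2 (λ x y → x := y :+ (x :- y)) refl (Y e + Y e′) (Y s) ⟩
        Y s + (Y e + Y e′ - Y s)              ≡⟨ ≡.cong (λ r → Y s + (Y e + Y e′ - Y r)) s≡ ⟩
        Y s + (Y e + Y e′ - Y (T ∸ t))        ≡⟨ ≡.cong₂ _+_ (R-≤ Y s≤e) (R-> Y e<t) ⟨
        R Y s + R Y t                         ∎
        where
        s≡ : s ≡ T ∸ t
        s≡ = ≡.trans (≡.sym (ℕ.m+n∸n≡m s t)) (≡.cong (_∸ t) s+t≡T)

      -- Two numbers of at most `e` with sum e + e′ are `e` and `e′` themselves in some order,
      -- because e exceeds e′ by at most 1. So the unreflected values impose no condition on one
      -- another.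
      R-low : ∀ {s t} → s ℕ.+ t ≡ T → s ℕ.≤ e → t ℕ.≤ e → R Y T ≈ R Y s + R Y t
      R-low {s} {t} s+t≡T s≤e t≤e = trans R-T (trans (low (ℕ.m≤n⇒m<n∨m≡n e′≤t))
        (sym (reflexive (≡.cong₂ _+_ (R-≤ Y s≤e) (R-≤ Y t≤e)))))
        where
        e′≤t : e′ ℕ.≤ t
        e′≤t = ℕ.+-cancelˡ-≤ e e′ t (ℕ.≤-trans (ℕ.≤-reflexive (≡.trans e+e′≡T (≡.sym s+t≡T))) (ℕ.+-monoˡ-≤ t s≤e))
        low : e′ ℕ.< t ⊎ e′ ≡ t → Y e + Y e′ ≈ Y s + Y t
        low (inj₂ ≡.refl) = +-congʳ (reflexive (≡.cong Y (ℕ.+-cancelʳ-≡ e′ e s (≡.trans e+e′≡T (≡.sym s+t≡T)))))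
        low (inj₁ e′<t) = trans (+-comm _ _) (reflexive (≡.cong₂ (λ x y → Y x + Y y) e′≡s (≡.sym t≡e)))
          where
          t≡e : t ≡ e
          t≡e = ℕ.≤-antisym t≤e (ℕ.≤-trans e≤1+e′ e′<t)
          e′≡s : e′ ≡ s
          e′≡s = ℕ.+-cancelʳ-≡ e e′ s (≡.trans (ℕ.+-comm e′ e) (≡.trans e+e′≡T (≡.trans (≡.sym s+t≡T) (≡.cong (s ℕ.+_) t≡e))))

      R-split : ∀ {s t} → s ℕ.+ t ≡ T → R Y T ≈ R Y s + R Y t
      R-split {s} {t} s+t≡T = cases (ℕ.≤-<-connex s e) (ℕ.≤-<-connex t e)
        where
        cases : s ℕ.≤ e ⊎ e ℕ.< s → t ℕ.≤ e ⊎ e ℕ.< t → R Y T ≈ R Y s + R Y t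
        cases (inj₁ s≤e) (inj₁ t≤e) = R-low s+t≡T s≤e t≤e
        cases (inj₁ s≤e) (inj₂ e<t) = R-mixed s+t≡T s≤e e<t
        cases (inj₂ e<s) (inj₁ t≤e) = trans (R-mixed (≡.trans (ℕ.+-comm t s) s+t≡T) t≤e e<s) (+-comm _ _)
        cases (inj₂ e<s) (inj₂ e<t) = ⊥-elim (ℕ.<-irrefl e+e′≡T (≡.subst (e ℕ.+ e′ ℕ.<_) s+t≡T
          (ℕ.+-mono-<-≤ e<s (ℕ.≤-trans e′≤e (ℕ.<⇒≤ e<t)))))

      R-additive : CeilingAdditive (suc T) k (R Y)
      R-additive {s} {t} 1≤s 1≤t s+t<a c≡ = trans (reflexive (≡.cong (R Y) s+t≡T)) (R-split {s} {t} s+t≡T)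
        where s+t≡T = sum-is-T 1≤s 1≤t s+t<a c≡

    module _ {X : ℕ → Carrier} (X-additive : CeilingAdditive (suc T) k X) where
      -- The relations say nothing about X(0), so it is replaced by 0; with this convention the
      -- pairing of s with T - s also covers s = T.
      Y : ℕ → Carrier
      Y zero    = 0#
      Y (suc s) = X (suc s)

      Y≡X : ∀ {s} → 1 ℕ.≤ s → Y s ≡ X s
      Y≡X {suc s} _ = ≡.refl

      X-split : ∀ {s t} → 1 ℕ.≤ s → 1 ℕ.≤ t → s ℕ.+ t ≡ T → X T ≈ X s + X t
      X-split {s} {t} 1≤s 1≤t s+t≡T = trans (reflexive (≡.cong X (≡.sym s+t≡T)))
        (X-additive 1≤s 1≤t (s≤s (ℕ.≤-reflexive s+t≡T)) (ceilings-add 1≤s 1≤t s+t≡T))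

      X-complement : ∀ {s} → 1 ℕ.≤ s → s ℕ.≤ T → X T ≈ X s + Y (T ∸ s)
      X-complement {s} 1≤s s≤T with T ∸ s in eq
      ... | suc r = X-split 1≤s (s≤s z≤n) (≡.trans (≡.cong (s ℕ.+_) (≡.sym eq)) (ℕ.m+[n∸m]≡n s≤T))
      ... | zero  = trans (reflexive (≡.cong X (ℕ.≤-antisym (ℕ.m∸n≡0⇒m≤n eq) s≤T))) (sym (+-identityʳ (X s)))

      RY≈X : ∀ {s} → 1 ℕ.≤ s → s ℕ.≤ T → R Y s ≈ X s
      RY≈X {s} 1≤s s≤T with ℕ.≤-<-connex s e
      ... | inj₁ s≤e = reflexive (≡.trans (R-≤ Y s≤e) (Y≡X 1≤s))
      ... | inj₂ e<s = begin
        R Y s                             ≡⟨ R-> Y e<s ⟩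
        Y e + Y e′ - Y (T ∸ s)            ≡⟨ ≡.cong₂ (λ x y → x + y - Y (T ∸ s)) (Y≡X 1≤e) (Y≡X 1≤e′) ⟩
        X e + X e′ - Y (T ∸ s)            ≈⟨ +-congʳ (X-split 1≤e 1≤e′ e+e′≡T) ⟨
        X T - Y (T ∸ s)                   ≈⟨ +-congʳ (X-complement 1≤s s≤T) ⟩
        X s + Y (T ∸ s) - Y (T ∸ s)       ≈⟨ solve 2 (λ x y → x :+ y :- y := x) refl (X s) (Y (T ∸ s)) ⟩
        X s                               ∎

      sum-D : ∀ {r} → r ℕ.≤ e → sum (λ j → X (residue j) * D j r) ≈ Y r
      sum-D {zero}  _   = sum≈0 {e} _ (λ j → zeroʳ (X (residue j)))
      sum-D {suc r} r<e = sum-*δ-ℕ (λ s → X (suc s)) r<e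

      -- `R` is linear in its first argument, and on 0, ..., e the combination of the `D j` with
      -- weights X(j + 1) is `Y`; the sum is thus `R Y`, which agrees with X.
      expand : ∀ {s} → 1 ℕ.≤ s → s ℕ.≤ T → sum (λ j → X (residue j) * R (D j) s) ≈ X s
      expand {s} 1≤s s≤T = trans (linear (ℕ.≤-<-connex s e)) (RY≈X 1≤s s≤T)
        where
        Σ[_] : (Fin e → Carrier) → Carrier
        Σ[ G ] = sum (λ j → X (residue j) * G j)
        Σ-+ : ∀ G G′ → Σ[ (λ j → G j + G′ j) ] ≈ Σ[ G ] + Σ[ G′ ]
        Σ-+ G G′ = trans (sum-cong-≋ (λ j → distribˡ (X (residue j)) (G j) (G′ j)))
                     (∑-distrib-+ (λ j → X (residue j) * G j) (λ j → X (residue j) * G′ j))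
        Σ-neg : ∀ G → Σ[ (λ j → - G j) ] ≈ - Σ[ G ]
        Σ-neg G = begin
          Σ[ (λ j → - G j) ]                        ≈⟨ sum-cong-≋ (λ j → solve 2 (λ x g → x :* (:- g) := (:- con (+ 1)) :* (x :* g)) refl (X (residue j)) (G j)) ⟩
          sum (λ j → - ℤ⟦ + 1 ⟧ * (X (residue j) * G j)) ≈⟨ *-distribˡ-sum (- ℤ⟦ + 1 ⟧) (λ j → X (residue j) * G j) ⟨
          - ℤ⟦ + 1 ⟧ * Σ[ G ]                       ≈⟨ solve 1 (λ x → (:- con (+ 1)) :* x := :- x) refl Σ[ G ] ⟩
          - Σ[ G ]                                  ∎
        linear : s ℕ.≤ e ⊎ e ℕ.< s → Σ[ (λ j → R (D j) s) ] ≈ R Y s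
        linear (inj₁ s≤e) = begin
          Σ[ (λ j → R (D j) s) ]   ≈⟨ sum-cong-≋ {e} (λ j → *-congˡ (reflexive (R-≤ (D j) s≤e))) ⟩
          Σ[ (λ j → D j s) ]       ≈⟨ sum-D s≤e ⟩
          Y s                      ≡⟨ R-≤ Y s≤e ⟨
          R Y s                    ∎
        linear (inj₂ e<s) = begin
          Σ[ (λ j → R (D j) s) ]
            ≈⟨ sum-cong-≋ {e} (λ j → *-congˡ (reflexive (R-> (D j) e<s))) ⟩
          Σ[ (λ j → D j e + D j e′ - D j r) ]
            ≈⟨ trans (Σ-+ (λ j → D j e + D j e′) (λ j → - D j r)) (+-cong (Σ-+ (λ j → D j e) (λ j → D j e′)) (Σ-neg (λ j → D j r))) ⟩
          Σ[ (λ j → D j e) ] + Σ[ (λ j → D j e′) ] - Σ[ (λ j → D j r) ]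
            ≈⟨ +-cong (+-cong (sum-D ℕ.≤-refl) (sum-D e′≤e)) (-‿cong (sum-D r≤e)) ⟩
          Y e + Y e′ - Y r
            ≡⟨ R-> Y e<s ⟨
          R Y s ∎
          where
          r = T ∸ s
          r≤e : r ℕ.≤ e
          r≤e = ℕ.≤-trans (ℕ.∸-monoʳ-≤ T (ℕ.<⇒≤ e<s)) (ℕ.≤-trans (ℕ.≤-reflexive
            (≡.trans (≡.cong (_∸ e) (≡.sym e+e′≡T)) (ℕ.m+n∸m≡n e e′))) e′≤e)

-- From the cone to the interval and back

module _ {c ℓ₁ ℓ₂ p q} (K : OrderedField c ℓ₁ ℓ₂)
    (a h k : ℕ) .{{_ : NonZero a}} (d : ℤ) (S : Pred ℕ p)
    (arithmetical : IsExtraGeneralizedArithmetical a h (suc k) d S)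
    (minimal : IsMinimalGeneratingFamily (generators a h (suc k) d))
    (F : Pred (Point K (a ∸ 1)) q)
    (isFace : IsFace K (GroupCone K a) F)
    (contains : FaceContains K a F S) where

  open FieldProperties K
  open FaceSpan K a
  open AdditiveFunctions K
  open ApérySet a h k d S arithmetical minimal using (σ; σ<a; 1≤σ; index; σ-index; index-σ; tight⇒additive; additive⇒tight)
  open import Relation.Binary.Reasoning.Setoid setoid

  private
    w = proj₁ (proj₂ contains)
    isTuple = proj₁ (proj₂ (proj₂ contains))
    w∈ri = proj₂ (proj₂ (proj₂ contains))
    W : Point K (a ∸ 1)
    W i = fromℕ K (w i)

  tight⇒ceilingAdditive : ∀ {x} → x ∈ TightSpace W → CeilingAdditive a k (λ s → x (index s))
  tight⇒ceilingAdditive x∈L {s} {t} 1≤s 1≤t s+t<a c≡ =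
    let r≡ , w≡ = additive⇒tight isTuple 1≤s 1≤t s+t<a c≡ in
    x∈L (index s) (index t) (index (s ℕ.+ t)) r≡
      (trans (reflexive (≡.cong (fromℕ K) w≡)) (fromℕ-+ (w (index s)) (w (index t))))

  ceilingAdditive⇒tight : ∀ {X} → CeilingAdditive a k X → (λ i → X (σ i)) ∈ TightSpace W
  ceilingAdditive⇒tight {X} X-additive i j l r≡ W≈ =
    let σ≡ , c≡ = tight⇒additive isTuple i j l r≡
                    (fromℕ-injective _ _ (trans W≈ (sym (fromℕ-+ (w i) (w j))))) in
    trans (reflexive (≡.cong X (≡.sym σ≡)))
      (X-additive (1≤σ i) (1≤σ j) (≡.subst (ℕ._< a) (≡.sym σ≡) (σ<a l)) (≡.trans c≡ (≡.cong ⌈_/1+ k ⌉ (≡.sym σ≡))))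

  -- Composition with `σ` and `index` identifies points of the tight space with additive functions
  -- on the interval, and evaluation at j + 1 with the coordinate at the residue of (j + 1)d.
  coordinates⇒face-dimension : ∀ {e} → Coordinates a k e → HasDimension K F e
  coordinates⇒face-dimension {e} coordinates = coordinates⇒dimension {F = F}
    (span⊆tight {F = F} (face⊆tight isFace w∈ri)) (tight⊆span isFace w∈ri)
    (λ i j l _ _ → sym (+-identityʳ 0#))
    (λ j → index (residue j)) (λ j i → basis j (σ i))
    (λ j → ceilingAdditive⇒tight (additive j))
    (λ i j → trans (reflexive (≡.cong (basis j) (σ-index {residue i} (s≤s z≤n) (ℕ.≤-<-trans (toℕ<n i) e<a)))) (dual i j))
    (λ {x} x∈L i → begin
      x i             ≡⟨ ≡.cong x (index-σ i) ⟨
      x (index (σ i)) ≈⟨ expand (tight⇒ceilingAdditive x∈L) (1≤σ i) (σ<a i) ⟩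
      sum (λ j → x (index (residue j)) * basis j (σ i)) ∎)
    where open Coordinates coordinates

open import Data.Nat.Base using (_<_)

theorem4p2 : ∀ {c ℓ₁ ℓ₂ p q} (K : OrderedField c ℓ₁ ℓ₂)
    (a h k : ℕ) .{{_ : NonZero a}} (d : ℤ) (S : Pred ℕ p) →
    IsExtraGeneralizedArithmetical a h k d S →
    IsMinimalGeneratingFamily (generators a h k d) →
    (F : Pred (Point K (a ∸ 1)) q) →
    IsFace K (GroupCone K a) F →
    FaceContains K a F S →
    (k ≡ a ∸ 1 → HasDimension K F (a ∸ 1)) ×
    (k ≡ a ∸ 2 → HasDimension K F ⌊ a /2⌋) ×
    (1 < k → k < a ∸ 2 → HasDimension K F 2) ×
    (k ≡ 1 → HasDimension K F 1)
theorem4p2 K a h zero d S arithmetical = contradiction (IsExtraGeneralizedArithmetical.1≤k arithmetical) λ ()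
theorem4p2 K (suc zero) h (suc k) d S arithmetical with IsExtraGeneralizedArithmetical.k<a arithmetical
... | s≤s ()
theorem4p2 K (suc (suc n)) h (suc k) d S arithmetical minimal F isFace contains =
  (λ { ≡.refl → dimension (full-coordinates k) }) ,
  -- For T = a - 1 = 2 + k, the number ⌊a/2⌋ is by definition ⌈T/2⌉, so the two halves of T are the
  -- required `e` and `e′`.
  (λ { ≡.refl → dimension (half-coordinates k ⌊ 3 ℕ.+ k /2⌋ ⌊ 2 ℕ.+ k /2⌋
         (≡.trans (ℕ.+-comm ⌈ 2 ℕ.+ k /2⌉ _) (ℕ.⌊n/2⌋+⌈n/2⌉≡n (2 ℕ.+ k)))
         (s≤s z≤n) (ℕ.⌊n/2⌋≤⌈n/2⌉ (2 ℕ.+ k)) (s≤s (ℕ.⌊n/2⌋-mono (ℕ.n≤1+n (suc k))))) }) ,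
  -- Taking `1 < k` apart writes the theorem's k as 2 + k for the newly bound `k`, which is the
  -- parameter of the plane case.
  (λ { (s≤s (s≤s {n = k} _)) 2+k<n → dimension (plane-coordinates (2 ℕ.+ n) k (s≤s (s≤s 2+k<n))) }) ,
  (λ { ≡.refl → dimension (line-coordinates (2 ℕ.+ n) (s≤s (s≤s z≤n))) })
  where
  dimension : ∀ {e} → AdditiveFunctions.Coordinates K (2 ℕ.+ n) k e → HasDimension K F e
  dimension = coordinates⇒face-dimension K (2 ℕ.+ n) h k d S arithmetical minimal F isFace contains
  open AdditiveFunctions K
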